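{- For all positive integers $n,k,m$ with $k+m\not\equiv 2\pmod 3$, \[ \det\left(\mu^{\le k+m-1}_{n+i+j+2m-2}(\mathbf{1},\mathbf{1})\right)_{i,j=0}^{k-1} =(-1)^{n\lfloor (k+m)/3\rfloor}\det\left(\mu^{\le k+m-1}_{ -n-i-j}(\mathbf{1},\mathbf{1})\right)_{i,j=0}^{m-1}. \]
   Context: Let $\mathbf{b}=(b_i)_{i\ge0}$, $\boldsymbol{\lambda}=(\lambda_i)_{i\ge1}$ be sequences. A Motzkin path is a finite sequence of points in $\mathbb{Z}\times\mathbb{Z}_{\ge0}$ whose steps are each $(1,1)$, $(1,0)$ or $(1,-1)$. Its weight is the product of $b_i$ over horizontal steps starting at height $i$ and of $\lambda_i$ over down steps starting at height $i$. For $K\ge 0$ and $N\ge 0$, $\mu^{\le K}_N(\mathbf{b},\boldsymbol{\lambda})$ is the sum of weights of Motzkin paths from $(0,0)$ to $(N,0)$ staying weakly below the line $y=K$. Here $\mathbf{1}=(1,1,\dots)$, so $\mu^{\le K}_N(\mathbf{1},\mathbf{1})$ is the number of such paths. Negative indices: if a sequence $(f_N)_{N\ge0}$ satisfies a recurrence $f_N=c_1f_{N-1}+\cdots+c_df_{N-d}$ for all $N\ge d$ with $c_d\ne0$, it is extended uniquely to all $N\in\mathbb{Z}$ so that the recurrence holds for all $N\in\mathbb{Z}$ (the extension is independent of the chosen recurrence); $\mu^{\le K}_{ -N}$ denotes the values of this extension (they exist in the situation of the claim). -}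

module Defs where

open import Data.Nat as ℕ using (ℕ; zero; suc; _<ᵇ_)
open import Data.Bool using (if_then_else_)
open import Data.Integer as ℤ using (ℤ; +_; _+_; _*_; _-_; -_; 0ℤ; 1ℤ; _^_)
open import Data.Fin as Fin using (Fin; zero; suc; fromℕ; punchIn)
open import Data.Product using (Σ; _×_; _,_)
open import Relation.Binary.PropositionalEquality using (_≡_)
open import Relation.Nullary using (¬_)

Σ[<_] : (n : ℕ) → (Fin n → ℤ) → ℤ
Σ[< zero ] f = 0ℤ
Σ[< suc n ] f = f zero + Σ[< n ] (λ i → f (suc i))

det : (n : ℕ) → (Fin n → Fin n → ℤ) → ℤ
det zero M = 1ℤ
det (suc n) M =
  Σ[< suc n ] (λ j → ((- 1ℤ) ^ Fin.toℕ j) * (M zero j *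
     det n (λ r c → M (suc r) (punchIn j c))))

-- walk K b λ N h : weighted sum over paths of length N starting at height h,
-- ending at height 0, staying within heights 0..K.
-- Horizontal step at height i has weight b i; down step from height i has
-- weight λ i (λ indexed from 1); up steps have weight 1.
walk : ℕ → (ℕ → ℤ) → (ℕ → ℤ) → ℕ → ℕ → ℤ
walk K b λ' zero zero = 1ℤ
walk K b λ' zero (suc h) = 0ℤ
walk K b λ' (suc N) h =
    b h * walk K b λ' N h
  + (if h <ᵇ K then walk K b λ' N (suc h) else 0ℤ)
  + down h
  where
  down : ℕ → ℤ
  down zero = 0ℤ
  down (suc h') = λ' (suc h') * walk K b λ' N h'

μ≤ : ℕ → (ℕ → ℤ) → (ℕ → ℤ) → ℕ → ℤ
μ≤ K b λ' N = walk K b λ' N 0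

𝟏 : ℕ → ℤ
𝟏 _ = 1ℤ

-- g : ℤ → ℤ is the extension of f : ℕ → ℤ to all integers along a linear
-- recurrence g N = c₁ g(N-1) + ... + c_d g(N-d) (all N ∈ ℤ) with d ≥ 1, c_d ≠ 0.
-- Coefficient c i (i : Fin d) stands for c_{i+1}.
IsRecExtension : (ℕ → ℤ) → (ℤ → ℤ) → Set
IsRecExtension f g =
  ((N : ℕ) → g (+ N) ≡ f N) ×
  Σ ℕ (λ e → Σ (Fin (suc e) → ℤ) (λ c →
     (¬ (c (fromℕ e) ≡ 0ℤ)) ×
     ((N : ℤ) → g N ≡ Σ[< suc e ] (λ i → c i * g (N - + (suc (Fin.toℕ i)))))))

{-# OPTIONS --safe #-}
-- Write d = k + m and let A be the d × d tridiagonal matrix of ones, the transfer matrix of the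
-- strip of heights 0, …, d - 1. Reading the path recurrence as a recurrence in the height,
-- starting from g, gives vectors w N (N ∈ ℤ) with A (w N) = w (N + 1), where w 0 is the first
-- unit vector; the component at height d vanishes for N ≥ 0, hence, by the linear recurrence of
-- g, for all N. Let v N be w N in reversed order. As A is symmetric and persymmetric,
-- ⟨w M, w N⟩ = ⟨v M, v N⟩ = g (M + N), while ⟨w M, v N⟩ = 0 when 0 ≤ M + N < d - 1.
-- So a suitable d × d matrix of inner products has one of the two Hankel determinants as a
-- diagonal block and 0 in a corner, the other diagonal block being a product L Lᵀ with L
-- unitriangular. Applying A to the left vectors n + 2m - 2 times leads from one determinant to
-- the other and multiplies by a power of det A = (-1) ^ ⌊ d / 3 ⌋.
module Submission where

open import Defs
open import Data.Bool using (true; false; if_then_else_)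
open import Data.Empty using (⊥-elim)
open import Data.Fin using (Fin; zero; suc; toℕ; fromℕ; punchIn; _↑ˡ_; _↑ʳ_; splitAt; opposite)
open import Data.Fin.Permutation using (reverse)
import Data.Fin.Properties as Fin
open import Data.Integer using (ℤ; +_; -[1+_]; -_; 0ℤ; 1ℤ; _^_)
  renaming (suc to sucℤ; _+_ to _+ℤ_; _*_ to _*ℤ_; _-_ to _-ℤ_)
import Data.Integer.Properties as ℤ
open import Data.Integer.Tactic.RingSolver using (solve-∀)
open import Data.Nat using (ℕ; zero; suc; _≤_; _<_; z≤n; s≤s; _+_; _*_; _∸_; _<ᵇ_)
open import Data.Nat.Divisibility using (∣-refl)
open import Data.Nat.DivMod using (_/_; _%_)
import Data.Nat.DivMod as ℕ
import Data.Nat.Properties as ℕ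
import Data.Nat.Tactic.RingSolver as ℕSolver
open import Data.Product using (_×_; _,_; proj₁; proj₂)
open import Data.Sum using (_⊎_; inj₁; inj₂)
open import Data.Unit using (⊤; tt)
open import Data.Vec.Functional using (_∷_; head; tail)
open import Function using (_∘_)
open import Relation.Binary.PropositionalEquality
  using (_≡_; _≢_; refl; sym; trans; cong; cong₂; subst; subst₂; module ≡-Reasoning)
open import Relation.Nullary using (¬_)
import Algebra.Properties.CommutativeMonoid.Sum ℤ.+-0-commutativeMonoid as Sum
open ≡-Reasoning

-- Determinants

Σ≡sum : ∀ n (f : Fin n → ℤ) → Σ[< n ] f ≡ Sum.sum f
Σ≡sum zero    f = refl
Σ≡sum (suc n) f = cong (f zero +ℤ_) (Σ≡sum n (f ∘ suc))

Σ-cong : ∀ n {f g : Fin n → ℤ} → (∀ i → f i ≡ g i) → Σ[< n ] f ≡ Σ[< n ] g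
Σ-cong zero    f≗g = refl
Σ-cong (suc n) f≗g = cong₂ _+ℤ_ (f≗g zero) (Σ-cong n (f≗g ∘ suc))

Σ-zero : ∀ n {f : Fin n → ℤ} → (∀ i → f i ≡ 0ℤ) → Σ[< n ] f ≡ 0ℤ
Σ-zero zero    f≗0 = refl
Σ-zero (suc n) f≗0 = cong₂ _+ℤ_ (f≗0 zero) (Σ-zero n (f≗0 ∘ suc))

Σ-distrib-+ : ∀ n (f g : Fin n → ℤ) →
  Σ[< n ] (λ i → f i +ℤ g i) ≡ Σ[< n ] f +ℤ Σ[< n ] g
Σ-distrib-+ zero    f g = refl
Σ-distrib-+ (suc n) f g =
  trans (cong (f zero +ℤ g zero +ℤ_) (Σ-distrib-+ n (f ∘ suc) (g ∘ suc)))
        (lemma (f zero) (g zero) (Σ[< n ] (f ∘ suc)) (Σ[< n ] (g ∘ suc)))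
  where
  lemma : ∀ a b c d → (a +ℤ b) +ℤ (c +ℤ d) ≡ (a +ℤ c) +ℤ (b +ℤ d)
  lemma = solve-∀

*-distribˡ-Σ : ∀ n a (f : Fin n → ℤ) → a *ℤ Σ[< n ] f ≡ Σ[< n ] (λ i → a *ℤ f i)
*-distribˡ-Σ zero    a f = ℤ.*-zeroʳ a
*-distribˡ-Σ (suc n) a f =
  trans (ℤ.*-distribˡ-+ a (f zero) (Σ[< n ] (f ∘ suc)))
        (cong (a *ℤ f zero +ℤ_) (*-distribˡ-Σ n a (f ∘ suc)))

*-distribʳ-Σ : ∀ n (f : Fin n → ℤ) a → Σ[< n ] f *ℤ a ≡ Σ[< n ] (λ i → f i *ℤ a)
*-distribʳ-Σ n f a = begin
  Σ[< n ] f *ℤ a             ≡⟨ ℤ.*-comm (Σ[< n ] f) a ⟩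
  a *ℤ Σ[< n ] f             ≡⟨ *-distribˡ-Σ n a f ⟩
  Σ[< n ] (λ i → a *ℤ f i)   ≡⟨ Σ-cong n (λ i → ℤ.*-comm a (f i)) ⟩
  Σ[< n ] (λ i → f i *ℤ a)   ∎

Σ-comm : ∀ m n (f : Fin m → Fin n → ℤ) →
  Σ[< m ] (λ i → Σ[< n ] (f i)) ≡ Σ[< n ] (λ j → Σ[< m ] (λ i → f i j))
Σ-comm zero    n f = sym (Σ-zero n (λ _ → refl))
Σ-comm (suc m) n f =
  trans (cong (Σ[< n ] (f zero) +ℤ_) (Σ-comm m n (f ∘ suc)))
        (sym (Σ-distrib-+ n (f zero) (λ j → Σ[< m ] (λ i → f (suc i) j))))

Σ-remove : ∀ n (f : Fin (suc n) → ℤ) j → Σ[< suc n ] f ≡ f j +ℤ Σ[< n ] (f ∘ punchIn j)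
Σ-remove n f j = begin
  Σ[< suc n ] f                    ≡⟨ Σ≡sum (suc n) f ⟩
  Sum.sum f                        ≡⟨ Sum.sum-remove {i = j} f ⟩
  f j +ℤ Sum.sum (f ∘ punchIn j)   ≡⟨ cong (f j +ℤ_) (Σ≡sum n (f ∘ punchIn j)) ⟨
  f j +ℤ Σ[< n ] (f ∘ punchIn j)   ∎

Σ-reverse : ∀ n (f : Fin n → ℤ) → Σ[< n ] (f ∘ opposite) ≡ Σ[< n ] f
Σ-reverse n f = begin
  Σ[< n ] (f ∘ opposite)   ≡⟨ Σ≡sum n (f ∘ opposite) ⟩
  Sum.sum (f ∘ opposite)   ≡⟨ Sum.sum-permute f reverse ⟨
  Sum.sum f                ≡⟨ Σ≡sum n f ⟨
  Σ[< n ] f                ∎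

-- Alternating forms in a family of rows

Row : ℕ → Set
Row d = Fin d → ℤ

-- Pointwise equal families need not be identical as functions, so invariance under pointwise
-- equality is made part of the notion of a form.
Congruent : ∀ {d n} → ((Fin n → Row d) → ℤ) → Set
Congruent F = ∀ {v w} → (∀ i x → v i x ≡ w i x) → F v ≡ F w

LinearInHead : ∀ {d n} → ((Fin (suc n) → Row d) → ℤ) → Set
LinearInHead F = ∀ a u v w →
  F ((λ x → u x +ℤ a *ℤ v x) ∷ w) ≡ F (u ∷ w) +ℤ a *ℤ F (v ∷ w)

-- Only the first two arguments are exchanged; later adjacent pairs are reached through
-- `Alternating`, which fixes the arguments before them.
SkewInHead : ∀ {d} n → ((Fin (suc n) → Row d) → ℤ) → Set
SkewInHead zero    F = ⊤
SkewInHead (suc n) F = ∀ u v w → F (u ∷ v ∷ w) ≡ - F (v ∷ u ∷ w)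

-- Over ℤ, which has no 2-torsion, antisymmetry is equivalent to being alternating.
Alternating : ∀ {d} n → ((Fin n → Row d) → ℤ) → Set
Alternating zero    F = Congruent F
Alternating (suc n) F =
  Congruent F × LinearInHead F × SkewInHead n F × (∀ v → Alternating n (λ w → F (v ∷ w)))

∷-η : ∀ {d n} (w : Fin (suc n) → Row d) i x → w i x ≡ (head w ∷ tail w) i x
∷-η w zero    x = refl
∷-η w (suc i) x = refl

∷-congʳ : ∀ {d n} u {v w : Fin n → Row d} → (∀ i x → v i x ≡ w i x) →
  ∀ i x → (u ∷ v) i x ≡ (u ∷ w) i x
∷-congʳ u v≗w zero    x = refl
∷-congʳ u v≗w (suc i) x = v≗w i x

x≡-x⇒x≡0 : ∀ x → x ≡ - x → x ≡ 0ℤ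
x≡-x⇒x≡0 (+ zero)  _  = refl
x≡-x⇒x≡0 (+ suc n) ()
x≡-x⇒x≡0 -[1+ n ] ()

alternating-repeat : ∀ {d n} {F : (Fin (suc (suc n)) → Row d) → ℤ} → Alternating (suc (suc n)) F →
  ∀ u w → F (u ∷ u ∷ w) ≡ 0ℤ
alternating-repeat (_ , _ , skew , _) u w = x≡-x⇒x≡0 _ (skew u u w)

-- Induction over the rows of `w`: linearity in the second argument strips the first row of its
-- multiple of `u`, since a repeated `u` gives 0. A swap then puts that row in front, where it stays
-- fixed while the induction treats the rest, and a second swap restores the order.
alternating-addHead : ∀ {d} n (F : (Fin (suc n) → Row d) → ℤ) → Alternating (suc n) F →
  ∀ u (a : Fin n → ℤ) w → F (u ∷ (λ i x → w i x +ℤ a i *ℤ u x)) ≡ F (u ∷ w)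
alternating-addHead zero    F (congF , _) u a w = congF (∷-congʳ u (λ ()))
alternating-addHead (suc n) F altF@(congF , linF , skewF , tailF) u a w = begin
  F (u ∷ w⁺)
    ≡⟨ congF (∷-congʳ u (∷-η w⁺)) ⟩
  F (u ∷ head w⁺ ∷ tail w⁺)
    ≡⟨ proj₁ (proj₂ (tailF u)) (a zero) (head w) u (tail w⁺) ⟩
  F (u ∷ head w ∷ tail w⁺) +ℤ a zero *ℤ F (u ∷ u ∷ tail w⁺)
    ≡⟨ cong (λ z → F (u ∷ head w ∷ tail w⁺) +ℤ a zero *ℤ z) (alternating-repeat altF u (tail w⁺)) ⟩
  F (u ∷ head w ∷ tail w⁺) +ℤ a zero *ℤ 0ℤ
    ≡⟨ lemma (F (u ∷ head w ∷ tail w⁺)) (a zero) ⟩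
  F (u ∷ head w ∷ tail w⁺)
    ≡⟨ skewF u (head w) (tail w⁺) ⟩
  - F (head w ∷ u ∷ tail w⁺)
    ≡⟨ cong -_ (alternating-addHead n (λ v → F (head w ∷ v)) (tailF (head w)) u (tail a) (tail w)) ⟩
  - F (head w ∷ u ∷ tail w)
    ≡⟨ skewF u (head w) (tail w) ⟨
  F (u ∷ head w ∷ tail w)
    ≡⟨ congF (∷-congʳ u (∷-η w)) ⟨
  F (u ∷ w) ∎
  where
  w⁺ = λ i x → w i x +ℤ a i *ℤ u x
  lemma : ∀ p q → p +ℤ q *ℤ 0ℤ ≡ p
  lemma = solve-∀

sgn : ∀ {n} → Fin n → ℤ
sgn j = (- 1ℤ) ^ toℕ j

-- Row `j` reaches the front by `j` adjacent exchanges, each contributing a factor -1.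
alternating-moveToHead : ∀ {d} n (F : (Fin (suc n) → Row d) → ℤ) → Alternating (suc n) F →
  ∀ v j → F (v j ∷ (v ∘ punchIn j)) ≡ sgn j *ℤ F v
alternating-moveToHead n F (congF , _) v zero =
  trans (congF λ { zero x → refl ; (suc i) x → refl }) (sym (ℤ.*-identityˡ (F v)))
alternating-moveToHead (suc n) F (congF , _ , skewF , tailF) v (suc j) = begin
  F (v (suc j) ∷ (v ∘ punchIn (suc j)))
    ≡⟨ congF (∷-congʳ (v (suc j)) (λ { zero x → refl ; (suc i) x → refl })) ⟩
  F (v (suc j) ∷ head v ∷ (tail v ∘ punchIn j))
    ≡⟨ skewF (v (suc j)) (head v) (tail v ∘ punchIn j) ⟩
  - F (head v ∷ tail v j ∷ (tail v ∘ punchIn j))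
    ≡⟨ cong -_ (alternating-moveToHead n (λ w → F (head v ∷ w)) (tailF (head v)) (tail v) j) ⟩
  - (sgn j *ℤ F (head v ∷ tail v))
    ≡⟨ cong (λ z → - (sgn j *ℤ z)) (congF (∷-η v)) ⟨
  - (sgn j *ℤ F v)
    ≡⟨ lemma (sgn j) (F v) ⟩
  sgn (suc j) *ℤ F v ∎
  where
  lemma : ∀ s x → - (s *ℤ x) ≡ (- 1ℤ *ℤ s) *ℤ x
  lemma = solve-∀

linearInHead-Σ : ∀ {d n} (F : (Fin (suc n) → Row d) → ℤ) → Congruent F → LinearInHead F →
  ∀ l (a : Fin l → ℤ) (v : Fin l → Row d) w →
  F ((λ x → Σ[< l ] (λ j → a j *ℤ v j x)) ∷ w) ≡ Σ[< l ] (λ j → a j *ℤ F (v j ∷ w))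
linearInHead-Σ F congF linF zero a v w =
  -- A zero row plus -1 times a zero row computes to a zero row, so linearity reads `x ≡ x - x` for
  -- the value `x` on it.
  lemma (F ((λ _ → 0ℤ) ∷ w)) (linF (- 1ℤ) (λ _ → 0ℤ) (λ _ → 0ℤ) w)
  where
  cancel : ∀ x → x +ℤ (- 1ℤ) *ℤ x ≡ 0ℤ
  cancel = solve-∀
  lemma : ∀ x → x ≡ x +ℤ (- 1ℤ) *ℤ x → x ≡ 0ℤ
  lemma x eq = trans eq (cancel x)
linearInHead-Σ F congF linF (suc l) a v w = begin
  F ((λ x → a zero *ℤ v zero x +ℤ rest x) ∷ w)
    ≡⟨ congF (λ { zero x → ℤ.+-comm (a zero *ℤ v zero x) (rest x) ; (suc i) x → refl }) ⟩
  F ((λ x → rest x +ℤ a zero *ℤ v zero x) ∷ w)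
    ≡⟨ linF (a zero) rest (v zero) w ⟩
  F (rest ∷ w) +ℤ a zero *ℤ F (v zero ∷ w)
    ≡⟨ cong (_+ℤ a zero *ℤ F (v zero ∷ w)) (linearInHead-Σ F congF linF l (tail a) (tail v) w) ⟩
  Σ[< l ] (λ j → tail a j *ℤ F (tail v j ∷ w)) +ℤ a zero *ℤ F (v zero ∷ w)
    ≡⟨ ℤ.+-comm (Σ[< l ] (λ j → tail a j *ℤ F (tail v j ∷ w))) _ ⟩
  Σ[< suc l ] (λ j → a j *ℤ F (v j ∷ w)) ∎
  where
  rest = λ x → Σ[< l ] (λ j → tail a j *ℤ tail v j x)

-- Expanding F along its first argument reproduces the Laplace expansion of det along its
-- first row: once v j is in front, multiples of v j may be dropped from the other rows.
alternating-det : ∀ {d} n (F : (Fin n → Row d) → ℤ) → Alternating n F →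
  ∀ (M : Fin n → Fin n → ℤ) v →
  F (λ r x → Σ[< n ] (λ l → M r l *ℤ v l x)) ≡ det n M *ℤ F v
alternating-det zero    F congF M v = trans (congF (λ ())) (sym (ℤ.*-identityˡ (F v)))
alternating-det (suc n) F altF@(congF , linF , skewF , tailF) M v = begin
  F (λ r → comb (M r))
    ≡⟨ congF (∷-η (λ r → comb (M r))) ⟩
  F (comb (M zero) ∷ rows)
    ≡⟨ linearInHead-Σ F congF linF (suc n) (M zero) v rows ⟩
  Σ[< suc n ] (λ j → M zero j *ℤ F (v j ∷ rows))
    ≡⟨ Σ-cong (suc n) (λ j → cong (M zero j *ℤ_) (expand j)) ⟩
  Σ[< suc n ] (λ j → M zero j *ℤ (minor j *ℤ (sgn j *ℤ F v)))
    ≡⟨ Σ-cong (suc n) (λ j → lemma (M zero j) (minor j) (sgn j) (F v)) ⟩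
  Σ[< suc n ] (λ j → (sgn j *ℤ (M zero j *ℤ minor j)) *ℤ F v)
    ≡⟨ *-distribʳ-Σ (suc n) (λ j → sgn j *ℤ (M zero j *ℤ minor j)) (F v) ⟨
  det (suc n) M *ℤ F v ∎
  where
  comb : (Fin (suc n) → ℤ) → _
  comb a = λ x → Σ[< suc n ] (λ l → a l *ℤ v l x)
  rows = λ r → comb (M (suc r))
  minor : Fin (suc n) → ℤ
  minor j = det n (λ r c → M (suc r) (punchIn j c))
  lemma : ∀ a b c e → a *ℤ (b *ℤ (c *ℤ e)) ≡ (c *ℤ (a *ℤ b)) *ℤ e
  lemma = solve-∀
  expand : ∀ j → F (v j ∷ rows) ≡ minor j *ℤ (sgn j *ℤ F v)
  expand j = begin
    F (v j ∷ rows)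
      ≡⟨ congF (∷-congʳ (v j) (λ r x →
           trans (Σ-remove n (λ l → M (suc r) l *ℤ v l x) j) (ℤ.+-comm (M (suc r) j *ℤ v j x) _))) ⟩
    F (v j ∷ (λ r x → others r x +ℤ M (suc r) j *ℤ v j x))
      ≡⟨ alternating-addHead n F altF (v j) (λ r → M (suc r) j) others ⟩
    F (v j ∷ others)
      ≡⟨ alternating-det n (λ w → F (v j ∷ w)) (tailF (v j))
           (λ r c → M (suc r) (punchIn j c)) (v ∘ punchIn j) ⟩
    minor j *ℤ F (v j ∷ (v ∘ punchIn j))
      ≡⟨ cong (minor j *ℤ_) (alternating-moveToHead n F altF v j) ⟩
    minor j *ℤ (sgn j *ℤ F v) ∎
    where
    others = λ r x → Σ[< n ] (λ c → M (suc r) (punchIn j c) *ℤ v (punchIn j c) x)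

-- With its first row fixed, a determinant is such a combination of minors: `a` will be the signs
-- and `b` the entries of the fixed row.
alternating-Σ : ∀ {d} n l (a b : Fin l → ℤ) (F : Fin l → (Fin n → Row d) → ℤ) →
  (∀ j → Alternating n (F j)) → Alternating n (λ w → Σ[< l ] (λ j → a j *ℤ (b j *ℤ F j w)))
alternating-Σ zero l a b F altF eq =
  Σ-cong l (λ j → cong (λ z → a j *ℤ (b j *ℤ z)) (altF j eq))
alternating-Σ {d} (suc n) l a b F altF =
  (λ eq → Σ-cong l (λ j → cong (λ z → a j *ℤ (b j *ℤ z)) (proj₁ (altF j) eq))) ,
  linear ,
  skew n F (λ j → proj₁ (proj₂ (proj₂ (altF j)))) ,
  (λ v → alternating-Σ n l a b (λ j w → F j (v ∷ w)) (λ j → proj₂ (proj₂ (proj₂ (altF j))) v))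
  where
  linear : LinearInHead (λ w → Σ[< l ] (λ j → a j *ℤ (b j *ℤ F j w)))
  linear c u v w = begin
    Σ[< l ] (λ j → a j *ℤ (b j *ℤ F j ((λ x → u x +ℤ c *ℤ v x) ∷ w)))
      ≡⟨ Σ-cong l (λ j → trans (cong (λ z → a j *ℤ (b j *ℤ z)) (proj₁ (proj₂ (altF j)) c u v w))
                               (lemma (a j) (b j) (F j (u ∷ w)) c (F j (v ∷ w)))) ⟩
    Σ[< l ] (λ j → a j *ℤ (b j *ℤ F j (u ∷ w)) +ℤ c *ℤ (a j *ℤ (b j *ℤ F j (v ∷ w))))
      ≡⟨ Σ-distrib-+ l _ _ ⟩
    Σ[< l ] (λ j → a j *ℤ (b j *ℤ F j (u ∷ w))) +ℤ Σ[< l ] (λ j → c *ℤ (a j *ℤ (b j *ℤ F j (v ∷ w))))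
      ≡⟨ cong (Σ[< l ] (λ j → a j *ℤ (b j *ℤ F j (u ∷ w))) +ℤ_) (*-distribˡ-Σ l c _) ⟨
    Σ[< l ] (λ j → a j *ℤ (b j *ℤ F j (u ∷ w))) +ℤ c *ℤ Σ[< l ] (λ j → a j *ℤ (b j *ℤ F j (v ∷ w))) ∎
    where
    lemma : ∀ p q x r y → p *ℤ (q *ℤ (x +ℤ r *ℤ y)) ≡ p *ℤ (q *ℤ x) +ℤ r *ℤ (p *ℤ (q *ℤ y))
    lemma = solve-∀
  skew : ∀ n (F : Fin l → (Fin (suc n) → Row d) → ℤ) → (∀ j → SkewInHead n (F j)) →
    SkewInHead n (λ w → Σ[< l ] (λ j → a j *ℤ (b j *ℤ F j w)))
  skew zero    F skewF = tt
  skew (suc n) F skewF u v w = begin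
    Σ[< l ] (λ j → a j *ℤ (b j *ℤ F j (u ∷ v ∷ w)))
      ≡⟨ Σ-cong l (λ j → trans (cong (λ z → a j *ℤ (b j *ℤ z)) (skewF j u v w))
                               (lemma (a j) (b j) (F j (v ∷ u ∷ w)))) ⟩
    Σ[< l ] (λ j → - 1ℤ *ℤ (a j *ℤ (b j *ℤ F j (v ∷ u ∷ w))))
      ≡⟨ *-distribˡ-Σ l (- 1ℤ) _ ⟨
    - 1ℤ *ℤ Σ[< l ] (λ j → a j *ℤ (b j *ℤ F j (v ∷ u ∷ w)))
      ≡⟨ ℤ.-1*i≡-i _ ⟩
    - Σ[< l ] (λ j → a j *ℤ (b j *ℤ F j (v ∷ u ∷ w))) ∎
    where
    lemma : ∀ p q x → p *ℤ (q *ℤ (- x)) ≡ - 1ℤ *ℤ (p *ℤ (q *ℤ x))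
    lemma = solve-∀

-- The determinant as an alternating form; multiplicativity

det-cong : ∀ n {M N : Fin n → Fin n → ℤ} → (∀ i j → M i j ≡ N i j) → det n M ≡ det n N
det-cong zero    eq = refl
det-cong (suc n) eq = Σ-cong (suc n) (λ j → cong (sgn j *ℤ_)
  (cong₂ _*ℤ_ (eq zero j) (det-cong n (λ r c → eq (suc r) (punchIn j c)))))

-- For j ≢ l, the order-preserving map that skips j and l (junk for j ≡ l).
punchIn₂ : ∀ {n} → Fin (suc (suc n)) → Fin (suc (suc n)) → Fin n → Fin (suc (suc n))
punchIn₂ zero    zero    x       = suc (suc x)
punchIn₂ zero    (suc l) x       = suc (punchIn l x)
punchIn₂ (suc j) zero    x       = suc (punchIn j x)
punchIn₂ (suc j) (suc l) zero    = zero
punchIn₂ (suc j) (suc l) (suc x) = suc (punchIn₂ j l x)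

punchIn₂-comm : ∀ {n} j l (x : Fin n) → punchIn₂ j l x ≡ punchIn₂ l j x
punchIn₂-comm zero    zero    x       = refl
punchIn₂-comm zero    (suc l) x       = refl
punchIn₂-comm (suc j) zero    x       = refl
punchIn₂-comm (suc j) (suc l) zero    = refl
punchIn₂-comm (suc j) (suc l) (suc x) = cong suc (punchIn₂-comm j l x)

-- Describes the columns left after two successive deletions by the unordered pair of deleted
-- columns, so that second-order minors become symmetric in that pair.
punchIn₂-punchIn : ∀ {n} j c (x : Fin n) → punchIn₂ j (punchIn j c) x ≡ punchIn j (punchIn c x)
punchIn₂-punchIn zero    c       x       = refl
punchIn₂-punchIn (suc j) zero    x       = refl
punchIn₂-punchIn (suc j) (suc c) zero    = refl
punchIn₂-punchIn (suc j) (suc c) (suc x) = cong suc (punchIn₂-punchIn j c x)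

-- The sum runs over ordered pairs of distinct columns, and `(j , l)` and `(l , j)` carry opposite
-- signs because the position of the second column drops by one once an earlier column is deleted.
-- In the induction, the pairs starting with column 0 cancel those ending with it.
Σ-sgn-symmetric : ∀ n (φ : Fin (suc n) → Fin (suc n) → ℤ) → (∀ j l → φ j l ≡ φ l j) →
  Σ[< suc n ] (λ j → sgn j *ℤ Σ[< n ] (λ c → sgn c *ℤ φ j (punchIn j c))) ≡ 0ℤ
Σ-sgn-symmetric zero    φ φ-comm = refl
Σ-sgn-symmetric (suc n) φ φ-comm = begin
  1ℤ *ℤ S +ℤ Σ[< suc n ] (λ j → sgn (suc j) *ℤ (1ℤ *ℤ φ (suc j) zero +ℤ Σ[< n ] (T (suc j) ∘ suc)))
    ≡⟨ cong (1ℤ *ℤ S +ℤ_) (Σ-cong (suc n) step) ⟩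
  1ℤ *ℤ S +ℤ Σ[< suc n ] (λ j → - 1ℤ *ℤ P j +ℤ sgn j *ℤ R j)
    ≡⟨ cong (1ℤ *ℤ S +ℤ_) (Σ-distrib-+ (suc n) (λ j → - 1ℤ *ℤ P j) (λ j → sgn j *ℤ R j)) ⟩
  1ℤ *ℤ S +ℤ (Σ[< suc n ] (λ j → - 1ℤ *ℤ P j) +ℤ Σ[< suc n ] (λ j → sgn j *ℤ R j))
    ≡⟨ cong₂ (λ y z → 1ℤ *ℤ S +ℤ (y +ℤ z))
         (sym (*-distribˡ-Σ (suc n) (- 1ℤ) P))
         (Σ-sgn-symmetric n (λ j l → φ (suc j) (suc l)) (λ j l → φ-comm (suc j) (suc l))) ⟩
  1ℤ *ℤ S +ℤ (- 1ℤ *ℤ S +ℤ 0ℤ)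
    ≡⟨ cancel S ⟩
  0ℤ ∎
  where
  T : Fin (suc (suc n)) → Fin (suc n) → ℤ
  T j c = sgn c *ℤ φ j (punchIn j c)
  P : Fin (suc n) → ℤ
  P c = sgn c *ℤ φ zero (suc c)
  S = Σ[< suc n ] P
  R : Fin (suc n) → ℤ
  R j = Σ[< n ] (λ c → sgn c *ℤ φ (suc j) (suc (punchIn j c)))
  cancel : ∀ s → 1ℤ *ℤ s +ℤ (- 1ℤ *ℤ s +ℤ 0ℤ) ≡ 0ℤ
  cancel = solve-∀
  lemma : ∀ s x r → (- 1ℤ *ℤ s) *ℤ (1ℤ *ℤ x +ℤ - 1ℤ *ℤ r) ≡ - 1ℤ *ℤ (s *ℤ x) +ℤ s *ℤ r
  lemma = solve-∀
  step : ∀ j → sgn (suc j) *ℤ (1ℤ *ℤ φ (suc j) zero +ℤ Σ[< n ] (T (suc j) ∘ suc))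
       ≡ - 1ℤ *ℤ (sgn j *ℤ φ zero (suc j)) +ℤ sgn j *ℤ R j
  step j = begin
    sgn (suc j) *ℤ (1ℤ *ℤ φ (suc j) zero +ℤ Σ[< n ] (T (suc j) ∘ suc))
      ≡⟨ cong₂ (λ y z → sgn (suc j) *ℤ (1ℤ *ℤ y +ℤ z)) (φ-comm (suc j) zero)
           (trans (Σ-cong n (λ c → ℤ.*-assoc (- 1ℤ) (sgn c) _)) (sym (*-distribˡ-Σ n (- 1ℤ) _))) ⟩
    sgn (suc j) *ℤ (1ℤ *ℤ φ zero (suc j) +ℤ - 1ℤ *ℤ R j)
      ≡⟨ lemma (sgn j) (φ zero (suc j)) (R j) ⟩
    - 1ℤ *ℤ (sgn j *ℤ φ zero (suc j)) +ℤ sgn j *ℤ R j ∎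

-- An arbitrary column selection `σ` keeps the minors in the same family, with `σ ∘ punchIn j` as
-- their selection, so induction applies to them.
detOfColumns : ∀ {d} n → (Fin n → Fin d) → (Fin n → Row d) → ℤ
detOfColumns n σ v = det n (λ r c → v r (σ c))

detOfColumns-linear : ∀ {d} n (σ : Fin (suc n) → Fin d) → LinearInHead (detOfColumns (suc n) σ)
detOfColumns-linear n σ a u v w = begin
  Σ[< suc n ] (λ j → sgn j *ℤ ((u (σ j) +ℤ a *ℤ v (σ j)) *ℤ D j))
    ≡⟨ Σ-cong (suc n) (λ j → lemma (sgn j) (u (σ j)) a (v (σ j)) (D j)) ⟩
  Σ[< suc n ] (λ j → sgn j *ℤ (u (σ j) *ℤ D j) +ℤ a *ℤ (sgn j *ℤ (v (σ j) *ℤ D j)))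
    ≡⟨ Σ-distrib-+ (suc n) (T u) (λ j → a *ℤ T v j) ⟩
  detOfColumns (suc n) σ (u ∷ w) +ℤ Σ[< suc n ] (λ j → a *ℤ T v j)
    ≡⟨ cong (detOfColumns (suc n) σ (u ∷ w) +ℤ_) (*-distribˡ-Σ (suc n) a (T v)) ⟨
  detOfColumns (suc n) σ (u ∷ w) +ℤ a *ℤ detOfColumns (suc n) σ (v ∷ w) ∎
  where
  D : Fin (suc n) → ℤ
  D j = detOfColumns n (σ ∘ punchIn j) w
  T : (Fin _ → ℤ) → Fin (suc n) → ℤ
  T x j = sgn j *ℤ (x (σ j) *ℤ D j)
  lemma : ∀ s x c y e → s *ℤ ((x +ℤ c *ℤ y) *ℤ e) ≡ s *ℤ (x *ℤ e) +ℤ c *ℤ (s *ℤ (y *ℤ e))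
  lemma = solve-∀

-- Expanding along two rows, the sum of the two determinants becomes a signed sum over ordered pairs
-- of columns whose terms `φ` are symmetric in the pair, and this cancels.
detOfColumns-skew : ∀ {d} n (σ : Fin (suc n) → Fin d) → SkewInHead n (detOfColumns (suc n) σ)
detOfColumns-skew zero    σ = tt
detOfColumns-skew (suc n) σ u v w = ℤ.i-j≡0⇒i≡j (det₂ u v) (- det₂ v u) (begin
  det₂ u v -ℤ - det₂ v u
    ≡⟨ cong (det₂ u v +ℤ_) (ℤ.neg-involutive (det₂ v u)) ⟩
  det₂ u v +ℤ det₂ v u
    ≡⟨ Σ-distrib-+ (suc (suc n)) (λ j → sgn j *ℤ (u (σ j) *ℤ L v j))
                                 (λ j → sgn j *ℤ (v (σ j) *ℤ L u j)) ⟨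
  Σ[< suc (suc n) ] (λ j → sgn j *ℤ (u (σ j) *ℤ L v j) +ℤ sgn j *ℤ (v (σ j) *ℤ L u j))
    ≡⟨ Σ-cong (suc (suc n)) step ⟩
  Σ[< suc (suc n) ] (λ j → sgn j *ℤ Σ[< suc n ] (λ c → sgn c *ℤ φ j (punchIn j c)))
    ≡⟨ Σ-sgn-symmetric (suc n) φ φ-comm ⟩
  0ℤ ∎)
  where
  det₂ = λ x y → detOfColumns (suc (suc n)) σ (x ∷ y ∷ w)
  D : Fin (suc (suc n)) → Fin (suc n) → ℤ
  D j c = detOfColumns n (σ ∘ punchIn j ∘ punchIn c) w
  ℓ : (Fin _ → ℤ) → Fin (suc (suc n)) → Fin (suc n) → ℤ
  ℓ x j c = sgn c *ℤ (x (σ (punchIn j c)) *ℤ D j c)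
  L : (Fin _ → ℤ) → Fin (suc (suc n)) → ℤ
  L x j = Σ[< suc n ] (ℓ x j)
  φ : Fin (suc (suc n)) → Fin (suc (suc n)) → ℤ
  φ j l = (u (σ j) *ℤ v (σ l) +ℤ v (σ j) *ℤ u (σ l)) *ℤ detOfColumns n (σ ∘ punchIn₂ j l) w
  φ-comm : ∀ j l → φ j l ≡ φ l j
  φ-comm j l = cong₂ _*ℤ_ (lemma (u (σ j)) (v (σ l)) (v (σ j)) (u (σ l)))
    (det-cong n (λ r x → cong (λ y → w r (σ y)) (punchIn₂-comm j l x)))
    where
    lemma : ∀ p q r s → p *ℤ q +ℤ r *ℤ s ≡ s *ℤ r +ℤ q *ℤ p
    lemma = solve-∀
  step : ∀ j → sgn j *ℤ (u (σ j) *ℤ L v j) +ℤ sgn j *ℤ (v (σ j) *ℤ L u j)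
       ≡ sgn j *ℤ Σ[< suc n ] (λ c → sgn c *ℤ φ j (punchIn j c))
  step j = begin
    sgn j *ℤ (u (σ j) *ℤ L v j) +ℤ sgn j *ℤ (v (σ j) *ℤ L u j)
      ≡⟨ ℤ.*-distribˡ-+ (sgn j) _ _ ⟨
    sgn j *ℤ (u (σ j) *ℤ L v j +ℤ v (σ j) *ℤ L u j)
      ≡⟨ cong (sgn j *ℤ_) (cong₂ _+ℤ_ (*-distribˡ-Σ (suc n) (u (σ j)) (ℓ v j))
                                   (*-distribˡ-Σ (suc n) (v (σ j)) (ℓ u j))) ⟩
    sgn j *ℤ (Σ[< suc n ] (λ c → u (σ j) *ℤ ℓ v j c) +ℤ Σ[< suc n ] (λ c → v (σ j) *ℤ ℓ u j c))
      ≡⟨ cong (sgn j *ℤ_) (Σ-distrib-+ (suc n) (λ c → u (σ j) *ℤ ℓ v j c) (λ c → v (σ j) *ℤ ℓ u j c)) ⟨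
    sgn j *ℤ Σ[< suc n ] (λ c → u (σ j) *ℤ ℓ v j c +ℤ v (σ j) *ℤ ℓ u j c)
      ≡⟨ cong (sgn j *ℤ_) (Σ-cong (suc n) (λ c →
           trans (lemma (u (σ j)) (sgn c) (v (σ (punchIn j c))) (D j c) (v (σ j)) (u (σ (punchIn j c))))
                 (cong (λ z → sgn c *ℤ ((u (σ j) *ℤ v (σ (punchIn j c)) +ℤ v (σ j) *ℤ u (σ (punchIn j c))) *ℤ z))
                    (det-cong n (λ r x → cong (λ y → w r (σ y)) (sym (punchIn₂-punchIn j c x))))))) ⟩
    sgn j *ℤ Σ[< suc n ] (λ c → sgn c *ℤ φ j (punchIn j c)) ∎
    where
    lemma : ∀ p s q e r t → p *ℤ (s *ℤ (q *ℤ e)) +ℤ r *ℤ (s *ℤ (t *ℤ e))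
          ≡ s *ℤ ((p *ℤ q +ℤ r *ℤ t) *ℤ e)
    lemma = solve-∀

detOfColumns-alternating : ∀ {d} n (σ : Fin n → Fin d) → Alternating n (detOfColumns n σ)
detOfColumns-alternating zero    σ eq = refl
detOfColumns-alternating (suc n) σ =
  (λ eq → det-cong (suc n) (λ i j → eq i (σ j))) ,
  detOfColumns-linear n σ ,
  detOfColumns-skew n σ ,
  (λ v → alternating-Σ n (suc n) sgn (v ∘ σ) (λ j → detOfColumns n (σ ∘ punchIn j))
           (λ j → detOfColumns-alternating n (σ ∘ punchIn j)))

-- The rows of the product are combinations of the rows of `N` with coefficients from `M`, so this
-- is `alternating-det` for the form `det n` itself.
det-* : ∀ n (M N : Fin n → Fin n → ℤ) →
  det n (λ i j → Σ[< n ] (λ l → M i l *ℤ N l j)) ≡ det n M *ℤ det n N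
det-* n M N = alternating-det n (det n) (detOfColumns-alternating n (λ j → j)) M N

-- Block triangular and unitriangular determinants

Matrix : ℕ → Set
Matrix n = Fin n → Fin n → ℤ

Σ-++ : ∀ m n (f : Fin (m + n) → ℤ) →
  Σ[< m + n ] f ≡ Σ[< m ] (λ i → f (i ↑ˡ n)) +ℤ Σ[< n ] (λ i → f (m ↑ʳ i))
Σ-++ zero    n f = sym (ℤ.+-identityˡ (Σ[< n ] f))
Σ-++ (suc m) n f =
  trans (cong (f zero +ℤ_) (Σ-++ m n (f ∘ suc)))
        (sym (ℤ.+-assoc (f zero) (Σ[< m ] (λ i → f (suc i ↑ˡ n))) (Σ[< n ] (λ i → f (suc m ↑ʳ i)))))

Σ-headOnly : ∀ n (f : Fin (suc n) → ℤ) → (∀ i → f (suc i) ≡ 0ℤ) → Σ[< suc n ] f ≡ f zero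
Σ-headOnly n f f≗0 = trans (cong (f zero +ℤ_) (Σ-zero n f≗0)) (ℤ.+-identityʳ (f zero))

-- The last n - a rows have their support in the last n - a - 1 columns.
det-zeroBlock : ∀ n (M : Matrix n) a → a < n →
  (∀ r c → a ≤ toℕ r → toℕ c ≤ a → M r c ≡ 0ℤ) → det n M ≡ 0ℤ
det-zeroBlock (suc n) M zero a<n M≗0 = Σ-zero (suc n) term
  where
  term : ∀ j → sgn j *ℤ (M zero j *ℤ det n (λ r c → M (suc r) (punchIn j c))) ≡ 0ℤ
  term zero = cong (λ z → 1ℤ *ℤ (z *ℤ det n (λ r c → M (suc r) (suc c)))) (M≗0 zero zero z≤n z≤n)
  term (suc j) = trans
    (cong (λ z → sgn (suc j) *ℤ (M zero (suc j) *ℤ z))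
      (det-zeroBlock n (λ r c → M (suc r) (punchIn (suc j) c)) zero (ℕ.≤-<-trans z≤n (Fin.toℕ<n j))
        (λ r c _ c≤0 → trans (cong (M (suc r)) (punchIn-first j c c≤0)) (M≗0 (suc r) zero z≤n z≤n))))
    (lemma (sgn (suc j)) (M zero (suc j)))
    where
    lemma : ∀ x y → x *ℤ (y *ℤ 0ℤ) ≡ 0ℤ
    lemma = solve-∀
    punchIn-first : ∀ {n} (j c : Fin n) → toℕ c ≤ 0 → punchIn (suc j) c ≡ zero
    punchIn-first j zero _ = refl
det-zeroBlock (suc n) M (suc a) (s≤s a<n) M≗0 = Σ-zero (suc n) term
  where
  toℕ-punchIn≤ : ∀ {n} (j : Fin (suc n)) c → toℕ (punchIn j c) ≤ suc (toℕ c)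
  toℕ-punchIn≤ zero    c       = ℕ.≤-refl
  toℕ-punchIn≤ (suc j) zero    = z≤n
  toℕ-punchIn≤ (suc j) (suc c) = s≤s (toℕ-punchIn≤ j c)
  lemma : ∀ x y → x *ℤ (y *ℤ 0ℤ) ≡ 0ℤ
  lemma = solve-∀
  term : ∀ j → sgn j *ℤ (M zero j *ℤ det n (λ r c → M (suc r) (punchIn j c))) ≡ 0ℤ
  -- Deleting row 0 and any one column lowers row and column indices by at most one, so each minor
  -- still has a zero block, with `a` in place of `suc a`.
  term j = trans
    (cong (λ z → sgn j *ℤ (M zero j *ℤ z))
      (det-zeroBlock n (λ r c → M (suc r) (punchIn j c)) a a<n
        (λ r c a≤r c≤a → M≗0 (suc r) (punchIn j c) (s≤s a≤r)
                           (ℕ.≤-trans (toℕ-punchIn≤ j c) (s≤s c≤a)))))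
    (lemma (sgn j) (M zero j))

punchIn-↑ˡ : ∀ {m} k (j : Fin (suc m)) (c : Fin m) → punchIn (j ↑ˡ k) (c ↑ˡ k) ≡ punchIn j c ↑ˡ k
punchIn-↑ˡ k zero    c       = refl
punchIn-↑ˡ k (suc j) zero    = refl
punchIn-↑ˡ k (suc j) (suc c) = cong suc (punchIn-↑ˡ k j c)

punchIn-↑ʳ : ∀ m k (j : Fin (suc m)) (c : Fin k) → punchIn (j ↑ˡ k) (m ↑ʳ c) ≡ suc m ↑ʳ c
punchIn-↑ʳ m       k zero    c = refl
punchIn-↑ʳ (suc m) k (suc j) c = cong suc (punchIn-↑ʳ m k j c)

minor : ∀ {n} → Matrix (suc n) → Fin (suc n) → Matrix n
minor M j r c = M (suc r) (punchIn j c)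

-- In the expansion along the first row, the columns of the right-hand block contribute nothing.
det-block-step : ∀ m k (M : Matrix (suc m + k)) →
  (∀ j → M zero (suc m ↑ʳ j) *ℤ det (m + k) (minor M (suc m ↑ʳ j)) ≡ 0ℤ) →
  (∀ j → det (m + k) (minor M (j ↑ˡ k)) ≡
         det m (λ r c → minor M (j ↑ˡ k) (r ↑ˡ k) (c ↑ˡ k)) *ℤ
         det k (λ r c → minor M (j ↑ˡ k) (m ↑ʳ r) (m ↑ʳ c))) →
  det (suc m + k) M ≡ det (suc m) (λ r c → M (r ↑ˡ k) (c ↑ˡ k)) *ℤ
                      det k (λ r c → M (suc m ↑ʳ r) (suc m ↑ʳ c))
det-block-step m k M right≗0 left = begin
  det (suc m + k) M
    ≡⟨ Σ-++ (suc m) k (λ j → sgn j *ℤ (M zero j *ℤ det (m + k) (minor M j))) ⟩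
  Σ[< suc m ] (λ j → sgn (j ↑ˡ k) *ℤ (M zero (j ↑ˡ k) *ℤ det (m + k) (minor M (j ↑ˡ k)))) +ℤ
  Σ[< k ] (λ j → sgn (suc m ↑ʳ j) *ℤ (M zero (suc m ↑ʳ j) *ℤ det (m + k) (minor M (suc m ↑ʳ j))))
    ≡⟨ cong₂ _+ℤ_ (Σ-cong (suc m) leftTerm)
         (Σ-zero k (λ j → trans (cong (sgn (suc m ↑ʳ j) *ℤ_) (right≗0 j)) (ℤ.*-zeroʳ (sgn (suc m ↑ʳ j))))) ⟩
  Σ[< suc m ] (λ j → (sgn j *ℤ (P zero j *ℤ det m (minor P j))) *ℤ det k R) +ℤ 0ℤ
    ≡⟨ ℤ.+-identityʳ (Σ[< suc m ] (λ j → (sgn j *ℤ (P zero j *ℤ det m (minor P j))) *ℤ det k R)) ⟩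
  Σ[< suc m ] (λ j → (sgn j *ℤ (P zero j *ℤ det m (minor P j))) *ℤ det k R)
    ≡⟨ *-distribʳ-Σ (suc m) (λ j → sgn j *ℤ (P zero j *ℤ det m (minor P j))) (det k R) ⟨
  det (suc m) P *ℤ det k R ∎
  where
  P : Matrix (suc m)
  P r c = M (r ↑ˡ k) (c ↑ˡ k)
  R : Matrix k
  R r c = M (suc m ↑ʳ r) (suc m ↑ʳ c)
  lemma : ∀ s x p q → s *ℤ (x *ℤ (p *ℤ q)) ≡ (s *ℤ (x *ℤ p)) *ℤ q
  lemma = solve-∀
  leftTerm : ∀ j → sgn (j ↑ˡ k) *ℤ (M zero (j ↑ˡ k) *ℤ det (m + k) (minor M (j ↑ˡ k)))
           ≡ (sgn j *ℤ (P zero j *ℤ det m (minor P j))) *ℤ det k R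
  leftTerm j = begin
    sgn (j ↑ˡ k) *ℤ (P zero j *ℤ det (m + k) (minor M (j ↑ˡ k)))
      ≡⟨ cong₂ (λ y z → (- 1ℤ) ^ y *ℤ (P zero j *ℤ z)) (Fin.toℕ-↑ˡ j k) (left j) ⟩
    sgn j *ℤ (P zero j *ℤ (det m (λ r c → minor M (j ↑ˡ k) (r ↑ˡ k) (c ↑ˡ k)) *ℤ
                           det k (λ r c → minor M (j ↑ˡ k) (m ↑ʳ r) (m ↑ʳ c))))
      ≡⟨ cong₂ (λ y z → sgn j *ℤ (P zero j *ℤ (y *ℤ z)))
           (det-cong m (λ r c → cong (M (suc (r ↑ˡ k))) (punchIn-↑ˡ k j c)))
           (det-cong k (λ r c → cong (M (suc (m ↑ʳ r))) (punchIn-↑ʳ m k j c))) ⟩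
    sgn j *ℤ (P zero j *ℤ (det m (minor P j) *ℤ det k R))
      ≡⟨ lemma (sgn j) (P zero j) (det m (minor P j)) (det k R) ⟩
    (sgn j *ℤ (P zero j *ℤ det m (minor P j))) *ℤ det k R ∎

-- The right-hand entries of the first row are zero, and the left-hand minors inherit the rest of
-- the zero block.
det-lowerBlock : ∀ m k (M : Matrix (m + k)) → (∀ i j → M (i ↑ˡ k) (m ↑ʳ j) ≡ 0ℤ) →
  det (m + k) M ≡ det m (λ r c → M (r ↑ˡ k) (c ↑ˡ k)) *ℤ det k (λ r c → M (m ↑ʳ r) (m ↑ʳ c))
det-lowerBlock zero    k M M≗0 = sym (ℤ.*-identityˡ (det k M))
det-lowerBlock (suc m) k M M≗0 = det-block-step m k M
  (λ j → cong (_*ℤ det (m + k) (minor M (suc m ↑ʳ j))) (M≗0 zero j))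
  (λ j → det-lowerBlock m k (minor M (j ↑ˡ k)) (λ r c →
     trans (cong (M (suc (r ↑ˡ k))) (punchIn-↑ʳ m k j c)) (M≗0 (suc r) c)))

-- Here the right-hand entries of the first row may be nonzero, but their minors vanish: the first
-- `m + 1` columns are kept, and the last `k` rows are zero on them, which is `det-zeroBlock` with
-- `a = m`.
det-upperBlock : ∀ m k (M : Matrix (m + k)) → (∀ i j → M (m ↑ʳ i) (j ↑ˡ k) ≡ 0ℤ) →
  det (m + k) M ≡ det m (λ r c → M (r ↑ˡ k) (c ↑ˡ k)) *ℤ det k (λ r c → M (m ↑ʳ r) (m ↑ʳ c))
det-upperBlock zero    k M M≗0 = sym (ℤ.*-identityˡ (det k M))
det-upperBlock (suc m) k M M≗0 = det-block-step m k M
  (λ j → trans (cong (M zero (suc m ↑ʳ j) *ℤ_) (rightMinor j)) (ℤ.*-zeroʳ (M zero (suc m ↑ʳ j))))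
  (λ j → det-upperBlock m k (minor M (j ↑ˡ k)) (λ r c →
     trans (cong (M (suc (m ↑ʳ r))) (punchIn-↑ˡ k j c)) (M≗0 r (punchIn j c))))
  where
  below : ∀ {r : Fin (m + k)} {c : Fin (suc m + k)} → m ≤ toℕ r → toℕ c ≤ m → M (suc r) c ≡ 0ℤ
  below {r} {c} m≤r c≤m with splitAt m r in eqr | splitAt (suc m) c in eqc
  ... | inj₁ r' | _ = ⊥-elim (ℕ.<⇒≱ (subst (_< m)
          (trans (sym (Fin.toℕ-↑ˡ r' k)) (cong toℕ (Fin.splitAt⁻¹-↑ˡ eqr))) (Fin.toℕ<n r')) m≤r)
  ... | inj₂ r' | inj₂ c' = ⊥-elim (ℕ.<⇒≱ (s≤s (ℕ.m≤m+n m (toℕ c')))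
          (subst (_≤ m) (trans (cong toℕ (sym (Fin.splitAt⁻¹-↑ʳ eqc))) (Fin.toℕ-↑ʳ (suc m) c')) c≤m))
  ... | inj₂ r' | inj₁ c' = trans (sym (cong₂ M (cong suc (Fin.splitAt⁻¹-↑ʳ eqr)) (Fin.splitAt⁻¹-↑ˡ eqc))) (M≗0 r' c')
  toℕ-punchIn-≤ : ∀ {n} (j : Fin (suc n)) (c : Fin n) → toℕ c < toℕ j → toℕ (punchIn j c) ≡ toℕ c
  toℕ-punchIn-≤ (suc j) zero    c<j       = refl
  toℕ-punchIn-≤ (suc j) (suc c) (s≤s c<j) = cong suc (toℕ-punchIn-≤ j c c<j)
  rightMinor : ∀ j → det (m + k) (minor M (suc m ↑ʳ j)) ≡ 0ℤ
  rightMinor j = det-zeroBlock (m + k) (minor M (suc m ↑ʳ j)) m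
    -- The existence of `j : Fin k` gives `k ≥ 1`, hence `m < m + k`.
    (ℕ.≤-trans (ℕ.≤-reflexive (sym (ℕ.+-comm m 1))) (ℕ.+-monoʳ-≤ m (ℕ.≤-trans (s≤s z≤n) (Fin.toℕ<n j))))
    (λ r c m≤r c≤m → below m≤r
      (ℕ.≤-trans (ℕ.≤-reflexive (toℕ-punchIn-≤ (suc m ↑ʳ j) c
        (ℕ.≤-trans (s≤s c≤m) (ℕ.≤-trans (ℕ.m≤m+n (suc m) (toℕ j))
          (ℕ.≤-reflexive (sym (Fin.toℕ-↑ʳ (suc m) j))))))) c≤m))

det₁ : ∀ (M : Matrix 1) → det 1 M ≡ M zero zero
det₁ M = lemma (M zero zero)
  where
  lemma : ∀ x → 1ℤ *ℤ (x *ℤ 1ℤ) +ℤ 0ℤ ≡ x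
  lemma = solve-∀

det-lowerUnitriangular : ∀ n (M : Matrix n) → (∀ i j → toℕ i < toℕ j → M i j ≡ 0ℤ) →
  (∀ i → M i i ≡ 1ℤ) → det n M ≡ 1ℤ
det-lowerUnitriangular zero    M M≗0 diag = refl
det-lowerUnitriangular (suc n) M M≗0 diag = begin
  det (suc n) M
    ≡⟨ det-lowerBlock 1 n M (λ { zero j → M≗0 zero (suc j) (s≤s z≤n) }) ⟩
  det 1 (λ r c → M (r ↑ˡ n) (c ↑ˡ n)) *ℤ det n (λ r c → M (suc r) (suc c))
    ≡⟨ cong₂ _*ℤ_ (trans (det₁ (λ r c → M (r ↑ˡ n) (c ↑ˡ n))) (diag zero))
         (det-lowerUnitriangular n (λ r c → M (suc r) (suc c))
           (λ i j i<j → M≗0 (suc i) (suc j) (s≤s i<j)) (diag ∘ suc)) ⟩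
  1ℤ ∎

det-upperUnitriangular : ∀ n (M : Matrix n) → (∀ i j → toℕ j < toℕ i → M i j ≡ 0ℤ) →
  (∀ i → M i i ≡ 1ℤ) → det n M ≡ 1ℤ
det-upperUnitriangular zero    M M≗0 diag = refl
det-upperUnitriangular (suc n) M M≗0 diag = begin
  det (suc n) M
    ≡⟨ det-upperBlock 1 n M (λ { i zero → M≗0 (suc i) zero (s≤s z≤n) }) ⟩
  det 1 (λ r c → M (r ↑ˡ n) (c ↑ˡ n)) *ℤ det n (λ r c → M (suc r) (suc c))
    ≡⟨ cong₂ _*ℤ_ (trans (det₁ (λ r c → M (r ↑ˡ n) (c ↑ˡ n))) (diag zero))
         (det-upperUnitriangular n (λ r c → M (suc r) (suc c))
           (λ i j j<i → M≗0 (suc i) (suc j) (s≤s j<i)) (diag ∘ suc)) ⟩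
  1ℤ ∎

-- The matrix is `L` times its transpose, a lower and an upper unitriangular factor.
det-gram : ∀ n (L : Matrix n) → (∀ i j → toℕ i < toℕ j → L i j ≡ 0ℤ) → (∀ i → L i i ≡ 1ℤ) →
  det n (λ i j → Σ[< n ] (λ l → L i l *ℤ L j l)) ≡ 1ℤ
det-gram n L L≗0 diag = trans (det-* n L (λ l j → L j l))
  (cong₂ _*ℤ_ (det-lowerUnitriangular n L L≗0 diag)
              (det-upperUnitriangular n (λ l j → L j l) (λ i j → L≗0 j i) diag))

det-gramᵀ : ∀ n (L : Matrix n) → (∀ i j → toℕ j < toℕ i → L i j ≡ 0ℤ) → (∀ i → L i i ≡ 1ℤ) →
  det n (λ i j → Σ[< n ] (λ l → L i l *ℤ L j l)) ≡ 1ℤ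
det-gramᵀ n L L≗0 diag = trans (det-* n L (λ l j → L j l))
  (cong₂ _*ℤ_ (det-upperUnitriangular n L L≗0 diag)
              (det-lowerUnitriangular n (λ l j → L j l) (λ i j → L≗0 j i) diag))

-- The tridiagonal matrix of ones

tridiag : ℕ → ℕ → ℤ
tridiag zero          zero          = 1ℤ
tridiag zero          (suc zero)    = 1ℤ
tridiag zero          (suc (suc _)) = 0ℤ
tridiag (suc a)       (suc b)       = tridiag a b
tridiag (suc zero)    zero          = 1ℤ
tridiag (suc (suc _)) zero          = 0ℤ

tridiag-sym : ∀ a b → tridiag a b ≡ tridiag b a
tridiag-sym zero          zero          = refl
tridiag-sym zero          (suc zero)    = refl
tridiag-sym zero          (suc (suc _)) = refl
tridiag-sym (suc zero)    zero          = refl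
tridiag-sym (suc (suc _)) zero          = refl
tridiag-sym (suc a)       (suc b)       = tridiag-sym a b

-- As `tridiag` strips successors from both indices, removing the first row and column yields the
-- smaller matrix by computation.
Tridiag : ∀ d → Matrix d
Tridiag d i j = tridiag (toℕ i) (toℕ j)

-- The first row has two nonzero entries; the first column of the minor at the second one is
-- `(1, 0, …, 0)`, which leaves `Tridiag d`.
det-Tridiag-step : ∀ d → det (suc (suc d)) (Tridiag (suc (suc d))) ≡
  det (suc d) (Tridiag (suc d)) -ℤ det d (Tridiag d)
det-Tridiag-step d = begin
  1ℤ *ℤ (1ℤ *ℤ D₁) +ℤ (- 1ℤ *ℤ 1ℤ *ℤ (1ℤ *ℤ det (suc d) N) +ℤ Σ[< d ] rest)
    ≡⟨ cong₂ (λ y z → 1ℤ *ℤ (1ℤ *ℤ D₁) +ℤ (- 1ℤ *ℤ 1ℤ *ℤ (1ℤ *ℤ y) +ℤ z)) N-det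
         (Σ-zero d (λ j → ℤ.*-zeroʳ (sgn (suc (suc j))))) ⟩
  1ℤ *ℤ (1ℤ *ℤ D₁) +ℤ (- 1ℤ *ℤ 1ℤ *ℤ (1ℤ *ℤ D₀) +ℤ 0ℤ)
    ≡⟨ lemma D₁ D₀ ⟩
  D₁ -ℤ D₀ ∎
  where
  D₁ = det (suc d) (Tridiag (suc d))
  D₀ = det d (Tridiag d)
  N : Matrix (suc d)
  N = minor (Tridiag (suc (suc d))) (suc zero)
  rest : Fin d → ℤ
  rest j = sgn (suc (suc j)) *ℤ (0ℤ *ℤ det (suc d) (minor (Tridiag (suc (suc d))) (suc (suc j))))
  N-det : det (suc d) N ≡ D₀
  N-det = begin
    det (suc d) N
      ≡⟨ det-upperBlock 1 d N (λ { i zero → refl }) ⟩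
    det 1 (λ r c → N (r ↑ˡ d) (c ↑ˡ d)) *ℤ D₀
      ≡⟨ cong (_*ℤ D₀) (det₁ (λ r c → N (r ↑ˡ d) (c ↑ˡ d))) ⟩
    1ℤ *ℤ D₀
      ≡⟨ ℤ.*-identityˡ D₀ ⟩
    D₀ ∎
  lemma : ∀ x y → 1ℤ *ℤ (1ℤ *ℤ x) +ℤ (- 1ℤ *ℤ 1ℤ *ℤ (1ℤ *ℤ y) +ℤ 0ℤ) ≡ x +ℤ - y
  lemma = solve-∀

-- Two uses of the recurrence give `D (d + 3) = - D d`, with `D 0 = D 1 = 1`; in the excluded
-- residue class the determinant is 0.
det-Tridiag : ∀ d → d % 3 ≢ 2 → det d (Tridiag d) ≡ (- 1ℤ) ^ (d / 3)
det-Tridiag 0 _ = refl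
det-Tridiag 1 _ = refl
det-Tridiag 2 d%3≢2 = ⊥-elim (d%3≢2 refl)
det-Tridiag (suc (suc (suc d))) d%3≢2 = begin
  D (3 + d)
    ≡⟨ det-Tridiag-step (suc d) ⟩
  D (2 + d) -ℤ D (1 + d)
    ≡⟨ cong (_-ℤ D (1 + d)) (det-Tridiag-step d) ⟩
  D (1 + d) -ℤ D d -ℤ D (1 + d)
    ≡⟨ lemma (D (1 + d)) (D d) ⟩
  - 1ℤ *ℤ D d
    ≡⟨ cong (- 1ℤ *ℤ_) (det-Tridiag d (d%3≢2 ∘ trans (trans (cong (_% 3) (ℕ.+-comm 3 d)) (ℕ.[m+n]%n≡m%n d 3)))) ⟩
  (- 1ℤ) ^ suc (d / 3)
    ≡⟨ cong ((- 1ℤ) ^_) (sym (ℕ.+-distrib-/-∣ˡ d (∣-refl {3}))) ⟩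
  (- 1ℤ) ^ ((3 + d) / 3) ∎
  where
  D : ℕ → ℤ
  D n = det n (Tridiag n)
  lemma : ∀ x y → x +ℤ - y +ℤ - x ≡ - 1ℤ *ℤ y
  lemma = solve-∀

-- Paths in a strip, extended to negative lengths

Σ-single : ∀ n (f : Fin n → ℤ) j → (∀ i → i ≢ j → f i ≡ 0ℤ) → Σ[< n ] f ≡ f j
Σ-single (suc n) f j f≗0 = begin
  Σ[< suc n ] f                    ≡⟨ Σ-remove n f j ⟩
  f j +ℤ Σ[< n ] (f ∘ punchIn j)   ≡⟨ cong (f j +ℤ_) (Σ-zero n (λ i → f≗0 (punchIn j i) (Fin.punchInᵢ≢i j i))) ⟩
  f j +ℤ 0ℤ                        ≡⟨ ℤ.+-identityʳ (f j) ⟩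
  f j                              ∎

Σ-truncate : ∀ k d (f : ℕ → ℤ) → k ≤ d → (∀ l → k ≤ l → l < d → f l ≡ 0ℤ) →
  Σ[< d ] (f ∘ toℕ) ≡ Σ[< k ] (f ∘ toℕ)
Σ-truncate zero    d       f _         f≗0 = Σ-zero d (λ i → f≗0 (toℕ i) z≤n (Fin.toℕ<n i))
Σ-truncate (suc k) (suc d) f (s≤s k≤d) f≗0 = cong (f 0 +ℤ_)
  (Σ-truncate k d (f ∘ suc) k≤d (λ l k≤l l<d → f≗0 (suc l) (s≤s k≤l) (s≤s l<d)))

≢fromℕ⇒toℕ< : ∀ e (i : Fin (suc e)) → i ≢ fromℕ e → toℕ i < e
≢fromℕ⇒toℕ< e i i≢e = ℕ.≤∧≢⇒< (ℕ.≤-pred (Fin.toℕ<n i))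
  (λ i≡e → i≢e (Fin.toℕ-injective (trans i≡e (sym (Fin.toℕ-fromℕ e)))))

Recurrent : ∀ e → (Fin (suc e) → ℤ) → (ℤ → ℤ) → Set
Recurrent e c f = ∀ N → f N ≡ Σ[< suc e ] (λ i → c i *ℤ f (N -ℤ + suc (toℕ i)))

-- Since the trailing coefficient is nonzero, the recurrence determines f backwards.
recurrent-vanishes : ∀ e c f → ¬ (c (fromℕ e) ≡ 0ℤ) → Recurrent e c f →
  (∀ N → f (+ N) ≡ 0ℤ) → ∀ N → f N ≡ 0ℤ
recurrent-vanishes e c f cₑ≢0 rec f≗0 = λ
  { (+ n)    → f≗0 n
  ; -[1+ n ] → from (suc n) 0 }
  where
  -- Induction on `j`: the value is 0 at all integers from `- j` upwards.
  from : ∀ j i → f (+ i -ℤ + j) ≡ 0ℤ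
  from zero    i       = trans (cong f (ℤ.+-identityʳ (+ i))) (f≗0 i)
  from (suc j) (suc i) = trans (cong f (lemma (+ i) (+ j))) (from j i)
    where
    lemma : ∀ x y → (1ℤ +ℤ x) -ℤ (1ℤ +ℤ y) ≡ x -ℤ y
    lemma = solve-∀
  from (suc j) zero with ℤ.i*j≡0⇒i≡0∨j≡0 (c (fromℕ e)) vanish
    where
    -- At this `N` the last argument in the recurrence is `- (j + 1)`, while `N` and all other
    -- arguments are at least `- j`.
    N = + e -ℤ + j
    T : Fin (suc e) → ℤ
    T i = c i *ℤ f (N -ℤ + suc (toℕ i))
    lemma₁ : ∀ x y z → (x +ℤ z) -ℤ y -ℤ x ≡ z -ℤ y
    lemma₁ = solve-∀
    lemma₂ : ∀ x y → x -ℤ y -ℤ (1ℤ +ℤ x) ≡ 0ℤ -ℤ (1ℤ +ℤ y)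
    lemma₂ = solve-∀
    others : ∀ i → i ≢ fromℕ e → T i ≡ 0ℤ
    others i i≢e = trans (cong (c i *ℤ_) (trans (cong f shift) (from j (e ∸ suc (toℕ i))))) (ℤ.*-zeroʳ (c i))
      where
      shift : N -ℤ + suc (toℕ i) ≡ + (e ∸ suc (toℕ i)) -ℤ + j
      shift = trans (cong (λ x → + x -ℤ + j -ℤ + suc (toℕ i)) (sym (ℕ.m+[n∸m]≡n (≢fromℕ⇒toℕ< e i i≢e))))
                    (lemma₁ (+ suc (toℕ i)) (+ j) (+ (e ∸ suc (toℕ i))))
    vanish : c (fromℕ e) *ℤ f (0ℤ -ℤ + suc j) ≡ 0ℤ
    vanish = begin
      c (fromℕ e) *ℤ f (0ℤ -ℤ + suc j)
        ≡⟨ cong (λ x → c (fromℕ e) *ℤ f x)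
             (trans (cong (λ x → N -ℤ + suc x) (Fin.toℕ-fromℕ e)) (lemma₂ (+ e) (+ j))) ⟨
      T (fromℕ e)    ≡⟨ Σ-single (suc e) T (fromℕ e) others ⟨
      Σ[< suc e ] T  ≡⟨ rec N ⟨
      f N            ≡⟨ from j e ⟩
      0ℤ             ∎
  ... | inj₁ cₑ≡0 = ⊥-elim (cₑ≢0 cₑ≡0)
  ... | inj₂ eq   = eq

-- For g = μ≤ K and N ≥ 0, U g (h + 1) N counts the paths of length N from height h;
-- the path recurrence, solved for the next height, makes sense for all N in ℤ.
U : (ℤ → ℤ) → ℕ → ℤ → ℤ
U g 0             N = 0ℤ
U g 1             N = g N
U g (suc (suc h)) N = U g (suc h) (sucℤ N) -ℤ U g (suc h) N -ℤ U g h N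

-- `U g h` is a combination of translates of `g` with constant coefficients.
recurrent-U : ∀ e c g → Recurrent e c g → ∀ h → Recurrent e c (U g h)
recurrent-U e c g rec zero          N = sym (Σ-zero (suc e) (λ i → ℤ.*-zeroʳ (c i)))
recurrent-U e c g rec (suc zero)    N = rec N
recurrent-U e c g rec (suc (suc h)) N = begin
  U g (suc h) (sucℤ N) -ℤ U g (suc h) N -ℤ U g h N
    ≡⟨ cong₂ _-ℤ_ (cong₂ _-ℤ_ (recurrent-U e c g rec (suc h) (sucℤ N)) (recurrent-U e c g rec (suc h) N))
                  (recurrent-U e c g rec h N) ⟩
  Σ[< suc e ] A -ℤ Σ[< suc e ] B -ℤ Σ[< suc e ] C
    ≡⟨ Σ-− ⟨
  Σ[< suc e ] (λ i → A i +ℤ (- 1ℤ *ℤ B i +ℤ - 1ℤ *ℤ C i))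
    ≡⟨ Σ-cong (suc e) (λ i → trans
         (cong (λ x → c i *ℤ U g (suc h) x +ℤ (- 1ℤ *ℤ B i +ℤ - 1ℤ *ℤ C i)) (shift N (+ suc (toℕ i))))
         (factor (c i) (U g (suc h) (sucℤ (N -ℤ + suc (toℕ i)))) (U g (suc h) (N -ℤ + suc (toℕ i)))
                 (U g h (N -ℤ + suc (toℕ i))))) ⟩
  Σ[< suc e ] (λ i → c i *ℤ U g (suc (suc h)) (N -ℤ + suc (toℕ i))) ∎
  where
  A B C : Fin (suc e) → ℤ
  A i = c i *ℤ U g (suc h) (sucℤ N -ℤ + suc (toℕ i))
  B i = c i *ℤ U g (suc h) (N -ℤ + suc (toℕ i))
  C i = c i *ℤ U g h (N -ℤ + suc (toℕ i))
  shift : ∀ x y → (1ℤ +ℤ x) -ℤ y ≡ 1ℤ +ℤ (x -ℤ y)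
  shift = solve-∀
  factor : ∀ p x y z → p *ℤ x +ℤ (- 1ℤ *ℤ (p *ℤ y) +ℤ - 1ℤ *ℤ (p *ℤ z)) ≡ p *ℤ (x -ℤ y -ℤ z)
  factor = solve-∀
  combine : ∀ x y z → x +ℤ (- 1ℤ *ℤ y +ℤ - 1ℤ *ℤ z) ≡ x -ℤ y -ℤ z
  combine = solve-∀
  Σ-− : Σ[< suc e ] (λ i → A i +ℤ (- 1ℤ *ℤ B i +ℤ - 1ℤ *ℤ C i))
      ≡ Σ[< suc e ] A -ℤ Σ[< suc e ] B -ℤ Σ[< suc e ] C
  Σ-− = begin
    Σ[< suc e ] (λ i → A i +ℤ (- 1ℤ *ℤ B i +ℤ - 1ℤ *ℤ C i))
      ≡⟨ Σ-distrib-+ (suc e) A (λ i → - 1ℤ *ℤ B i +ℤ - 1ℤ *ℤ C i) ⟩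
    Σ[< suc e ] A +ℤ Σ[< suc e ] (λ i → - 1ℤ *ℤ B i +ℤ - 1ℤ *ℤ C i)
      ≡⟨ cong (Σ[< suc e ] A +ℤ_) (Σ-distrib-+ (suc e) (λ i → - 1ℤ *ℤ B i) (λ i → - 1ℤ *ℤ C i)) ⟩
    Σ[< suc e ] A +ℤ (Σ[< suc e ] (λ i → - 1ℤ *ℤ B i) +ℤ Σ[< suc e ] (λ i → - 1ℤ *ℤ C i))
      ≡⟨ cong₂ (λ y z → Σ[< suc e ] A +ℤ (y +ℤ z)) (*-distribˡ-Σ (suc e) (- 1ℤ) B) (*-distribˡ-Σ (suc e) (- 1ℤ) C) ⟨
    Σ[< suc e ] A +ℤ (- 1ℤ *ℤ Σ[< suc e ] B +ℤ - 1ℤ *ℤ Σ[< suc e ] C)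
      ≡⟨ combine (Σ[< suc e ] A) (Σ[< suc e ] B) (Σ[< suc e ] C) ⟩
    Σ[< suc e ] A -ℤ Σ[< suc e ] B -ℤ Σ[< suc e ] C ∎

-- Path counts by starting height

paths : ℕ → ℕ → ℕ → ℤ
paths K zero    N = 0ℤ
paths K (suc h) N = walk K 𝟏 𝟏 N h

-- Index `suc h` stands for height `h`. Index 0 lies below the axis and has value 0, which spares
-- the lowest height a recurrence of its own.
paths-step : ∀ K h N → paths K (suc h) (suc N) ≡
  paths K (suc h) N +ℤ (if h <ᵇ K then paths K (suc (suc h)) N else 0ℤ) +ℤ paths K h N
paths-step K zero N =
  cong (λ x → x +ℤ (if 0 <ᵇ K then walk K 𝟏 𝟏 N 1 else 0ℤ) +ℤ 0ℤ) (ℤ.*-identityˡ (walk K 𝟏 𝟏 N 0))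
paths-step K (suc h) N =
  cong₂ (λ x y → x +ℤ (if suc h <ᵇ K then walk K 𝟏 𝟏 N (suc (suc h)) else 0ℤ) +ℤ y)
    (ℤ.*-identityˡ (walk K 𝟏 𝟏 N (suc h))) (ℤ.*-identityˡ (walk K 𝟏 𝟏 N h))

if-0 : ∀ b → (if b then 0ℤ else 0ℤ) ≡ 0ℤ
if-0 true  = refl
if-0 false = refl

paths-tooShort : ∀ K h N → N < h → paths K (suc h) N ≡ 0ℤ
paths-tooShort K (suc h) zero    _         = refl
paths-tooShort K (suc h) (suc N) (s≤s N<h) = begin
  paths K (suc (suc h)) (suc N)
    ≡⟨ paths-step K (suc h) N ⟩
  paths K (suc (suc h)) N +ℤ (if suc h <ᵇ K then paths K (suc (suc (suc h))) N else 0ℤ) +ℤ paths K (suc h) N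
    ≡⟨ cong₂ _+ℤ_ (cong₂ (λ x y → x +ℤ (if suc h <ᵇ K then y else 0ℤ))
         (paths-tooShort K (suc h) N (ℕ.m<n⇒m<1+n N<h))
         (paths-tooShort K (suc (suc h)) N (ℕ.m<n⇒m<1+n (ℕ.m<n⇒m<1+n N<h))))
         (paths-tooShort K h N N<h) ⟩
  0ℤ +ℤ (if suc h <ᵇ K then 0ℤ else 0ℤ) +ℤ 0ℤ
    ≡⟨ cong (λ x → 0ℤ +ℤ x +ℤ 0ℤ) (if-0 (suc h <ᵇ K)) ⟩
  0ℤ ∎

-- Only the straight descent reaches height 0 in `h` steps.
paths-descent : ∀ K h → paths K (suc h) h ≡ 1ℤ
paths-descent K zero    = refl
paths-descent K (suc h) = begin
  paths K (suc (suc h)) (suc h)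
    ≡⟨ paths-step K (suc h) h ⟩
  paths K (suc (suc h)) h +ℤ (if suc h <ᵇ K then paths K (suc (suc (suc h))) h else 0ℤ) +ℤ paths K (suc h) h
    ≡⟨ cong₂ _+ℤ_ (cong₂ (λ x y → x +ℤ (if suc h <ᵇ K then y else 0ℤ))
         (paths-tooShort K (suc h) h ℕ.≤-refl)
         (paths-tooShort K (suc (suc h)) h (ℕ.m<n⇒m<1+n ℕ.≤-refl)))
         (paths-descent K h) ⟩
  0ℤ +ℤ (if suc h <ᵇ K then 0ℤ else 0ℤ) +ℤ 1ℤ
    ≡⟨ cong (λ x → 0ℤ +ℤ x +ℤ 1ℤ) (if-0 (suc h <ᵇ K)) ⟩
  1ℤ ∎

<⇒<ᵇ≡true : ∀ {m n} → m < n → (m <ᵇ n) ≡ true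
<⇒<ᵇ≡true {zero}  (s≤s _)   = refl
<⇒<ᵇ≡true {suc m} (s≤s m<n) = <⇒<ᵇ≡true m<n

n<ᵇn≡false : ∀ n → (n <ᵇ n) ≡ false
n<ᵇn≡false zero    = refl
n<ᵇn≡false (suc n) = n<ᵇn≡false n

-- Below height `K` the up step is allowed, so the path recurrence can be solved for the paths
-- starting one unit higher.
U≡paths : ∀ K g → (∀ N → g (+ N) ≡ μ≤ K 𝟏 𝟏 N) →
  ∀ h N → h ≤ suc K → U g h (+ N) ≡ paths K h N
U≡paths K g g≗μ zero          N _ = refl
U≡paths K g g≗μ (suc zero)    N _ = g≗μ N
U≡paths K g g≗μ (suc (suc h)) N (s≤s h<K) = begin
  U g (suc h) (+ suc N) -ℤ U g (suc h) (+ N) -ℤ U g h (+ N)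
    ≡⟨ cong₂ _-ℤ_ (cong₂ _-ℤ_ (U≡paths K g g≗μ (suc h) (suc N) h<) (U≡paths K g g≗μ (suc h) N h<))
                  (U≡paths K g g≗μ h N (ℕ.≤-trans (ℕ.n≤1+n h) h<)) ⟩
  paths K (suc h) (suc N) -ℤ paths K (suc h) N -ℤ paths K h N
    ≡⟨ cong (λ x → x -ℤ paths K (suc h) N -ℤ paths K h N)
         (trans (paths-step K h N)
           (cong (λ b → paths K (suc h) N +ℤ (if b then paths K (suc (suc h)) N else 0ℤ) +ℤ paths K h N)
             (<⇒<ᵇ≡true h<K))) ⟩
  (paths K (suc h) N +ℤ paths K (suc (suc h)) N +ℤ paths K h N) -ℤ paths K (suc h) N -ℤ paths K h N
    ≡⟨ lemma (paths K (suc h) N) (paths K (suc (suc h)) N) (paths K h N) ⟩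
  paths K (suc (suc h)) N ∎
  where
  h< : suc h ≤ suc K
  h< = ℕ.≤-trans h<K (ℕ.n≤1+n K)
  lemma : ∀ x y z → (x +ℤ y +ℤ z) -ℤ x -ℤ z ≡ y
  lemma = solve-∀

-- At height `K` there is no up step, so solving the path recurrence for the next height leaves 0.
U-aboveTop : ∀ K g → (∀ N → g (+ N) ≡ μ≤ K 𝟏 𝟏 N) → ∀ N → U g (suc (suc K)) (+ N) ≡ 0ℤ
U-aboveTop K g g≗μ N = begin
  U g (suc K) (+ suc N) -ℤ U g (suc K) (+ N) -ℤ U g K (+ N)
    ≡⟨ cong₂ _-ℤ_ (cong₂ _-ℤ_ (U≡paths K g g≗μ (suc K) (suc N) ℕ.≤-refl) (U≡paths K g g≗μ (suc K) N ℕ.≤-refl))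
                  (U≡paths K g g≗μ K N (ℕ.n≤1+n K)) ⟩
  paths K (suc K) (suc N) -ℤ paths K (suc K) N -ℤ paths K K N
    ≡⟨ cong (λ x → x -ℤ paths K (suc K) N -ℤ paths K K N)
         (trans (paths-step K K N)
           (cong (λ b → paths K (suc K) N +ℤ (if b then paths K (suc (suc K)) N else 0ℤ) +ℤ paths K K N)
             (n<ᵇn≡false K))) ⟩
  (paths K (suc K) N +ℤ 0ℤ +ℤ paths K K N) -ℤ paths K (suc K) N -ℤ paths K K N
    ≡⟨ lemma (paths K (suc K) N) (paths K K N) ⟩
  0ℤ ∎
  where
  lemma : ∀ x z → (x +ℤ 0ℤ +ℤ z) -ℤ x -ℤ z ≡ 0ℤ
  lemma = solve-∀

-- Orbits of the tridiagonal matrix and their pairings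

-- N ↦ (f 1 N, …, f d N) is an orbit of the matrix Tridiag d.
record IsOrbit (d : ℕ) (f : ℕ → ℤ → ℤ) : Set where
  field
    bottom : ∀ N → f 0 N ≡ 0ℤ
    top    : ∀ N → f (suc d) N ≡ 0ℤ
    step   : ∀ h N → h < d → f (suc h) (sucℤ N) ≡ f h N +ℤ f (suc h) N +ℤ f (suc (suc h)) N

-- Column `suc x` has ones at `x`, `suc x` and `suc (suc x)`. The last of these falls outside the
-- matrix when `d` is `suc (suc x)`, and then `φ d ≡ 0ℤ` supplies its term.
Σ-tridiag : ∀ d (φ : ℕ → ℤ) x → suc x < d → φ d ≡ 0ℤ →
  Σ[< d ] (λ l → φ (toℕ l) *ℤ tridiag (toℕ l) (suc x)) ≡ φ x +ℤ φ (suc x) +ℤ φ (suc (suc x))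
Σ-tridiag (suc (suc zero)) φ zero _ φd≡0 =
  trans (lemma (φ 0) (φ 1)) (cong (φ 0 +ℤ φ 1 +ℤ_) (sym φd≡0))
  where
  lemma : ∀ x y → x *ℤ 1ℤ +ℤ (y *ℤ 1ℤ +ℤ 0ℤ) ≡ x +ℤ y +ℤ 0ℤ
  lemma = solve-∀
Σ-tridiag (suc (suc (suc d))) φ zero _ φd≡0 =
  trans (cong (λ z → φ 0 *ℤ 1ℤ +ℤ (φ 1 *ℤ 1ℤ +ℤ (φ 2 *ℤ 1ℤ +ℤ z)))
          (Σ-zero d (λ l → ℤ.*-zeroʳ (φ (suc (suc (suc (toℕ l))))))))
        (lemma (φ 0) (φ 1) (φ 2))
  where
  lemma : ∀ x y z → x *ℤ 1ℤ +ℤ (y *ℤ 1ℤ +ℤ (z *ℤ 1ℤ +ℤ 0ℤ)) ≡ x +ℤ y +ℤ z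
  lemma = solve-∀
Σ-tridiag (suc d) φ (suc x) (s≤s x<d) φd≡0 = begin
  φ 0 *ℤ 0ℤ +ℤ Σ[< d ] (λ l → φ (suc (toℕ l)) *ℤ tridiag (toℕ l) (suc x))
    ≡⟨ cong₂ _+ℤ_ (ℤ.*-zeroʳ (φ 0)) (Σ-tridiag d (φ ∘ suc) x x<d φd≡0) ⟩
  0ℤ +ℤ (φ (suc x) +ℤ φ (suc (suc x)) +ℤ φ (suc (suc (suc x))))
    ≡⟨ ℤ.+-identityˡ _ ⟩
  φ (suc x) +ℤ φ (suc (suc x)) +ℤ φ (suc (suc (suc x))) ∎

orbit-Tridiag : ∀ d f → IsOrbit d f → ∀ N x →
  Σ[< d ] (λ l → f (suc (toℕ l)) N *ℤ Tridiag d l x) ≡ f (suc (toℕ x)) (sucℤ N)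
orbit-Tridiag d f orb N x = begin
  -- Prepending the boundary value at index 0 shifts the columns by one, so that none of them is a
  -- first column.
  S                                            ≡⟨ ℤ.+-identityˡ S ⟨
  0ℤ *ℤ tridiag 0 (suc (toℕ x)) +ℤ S
    ≡⟨ cong (λ z → z *ℤ tridiag 0 (suc (toℕ x)) +ℤ S) (bottom N) ⟨
  f 0 N *ℤ tridiag 0 (suc (toℕ x)) +ℤ S
    ≡⟨ Σ-tridiag (suc d) (λ h → f h N) (toℕ x) (s≤s (Fin.toℕ<n x)) (top N) ⟩
  f (toℕ x) N +ℤ f (suc (toℕ x)) N +ℤ f (suc (suc (toℕ x))) N
    ≡⟨ step (toℕ x) N (Fin.toℕ<n x) ⟨
  f (suc (toℕ x)) (sucℤ N) ∎
  where
  open IsOrbit orb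
  S = Σ[< d ] (λ l → f (suc (toℕ l)) N *ℤ Tridiag d l x)

pairing : ∀ d → (ℕ → ℤ) → (ℕ → ℤ) → ℤ
pairing d φ ψ = Σ[< d ] (λ l → φ (suc (toℕ l)) *ℤ ψ (suc (toℕ l)))

pairing-comm : ∀ d φ ψ → pairing d φ ψ ≡ pairing d ψ φ
pairing-comm d φ ψ = Σ-cong d (λ l → ℤ.*-comm (φ (suc (toℕ l))) (ψ (suc (toℕ l))))

-- Self-adjointness of the symmetric matrix `Tridiag d`.
pairing-suc : ∀ d f f' → IsOrbit d f → IsOrbit d f' → ∀ M N →
  pairing d (λ h → f h (sucℤ M)) (λ h → f' h N) ≡ pairing d (λ h → f h M) (λ h → f' h (sucℤ N))
pairing-suc d f f' orb orb' M N = begin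
  Σ[< d ] (λ x → f (suc (toℕ x)) (sucℤ M) *ℤ v x)
    ≡⟨ Σ-cong d (λ x → trans (cong (_*ℤ v x) (sym (orbit-Tridiag d f orb M x)))
                             (*-distribʳ-Σ d (λ l → u l *ℤ Tridiag d l x) (v x))) ⟩
  Σ[< d ] (λ x → Σ[< d ] (λ l → (u l *ℤ Tridiag d l x) *ℤ v x))
    ≡⟨ Σ-comm d d (λ x l → (u l *ℤ Tridiag d l x) *ℤ v x) ⟩
  Σ[< d ] (λ l → Σ[< d ] (λ x → (u l *ℤ Tridiag d l x) *ℤ v x))
    ≡⟨ Σ-cong d (λ l → Σ-cong d (λ x → trans
         (cong (λ z → (u l *ℤ z) *ℤ v x) (tridiag-sym (toℕ l) (toℕ x)))
         (lemma (u l) (Tridiag d x l) (v x)))) ⟩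
  Σ[< d ] (λ l → Σ[< d ] (λ x → u l *ℤ (v x *ℤ Tridiag d x l)))
    ≡⟨ Σ-cong d (λ l → trans (sym (*-distribˡ-Σ d (u l) (λ x → v x *ℤ Tridiag d x l)))
                             (cong (u l *ℤ_) (orbit-Tridiag d f' orb' N l))) ⟩
  Σ[< d ] (λ l → u l *ℤ f' (suc (toℕ l)) (sucℤ N)) ∎
  where
  u v : Fin d → ℤ
  u l = f (suc (toℕ l)) M
  v x = f' (suc (toℕ x)) N
  lemma : ∀ x y z → (x *ℤ y) *ℤ z ≡ x *ℤ (z *ℤ y)
  lemma = solve-∀

-- Units are moved from the first argument to the second until the first is 0; for a negative first
-- argument the exchange is read backwards.
depends-on-sum : (b : ℤ → ℤ → ℤ) → (∀ M N → b (sucℤ M) N ≡ b M (sucℤ N)) →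
  ∀ M N → b M N ≡ b 0ℤ (M +ℤ N)
depends-on-sum b shift (+ zero)  N = cong (b 0ℤ) (sym (ℤ.+-identityˡ N))
depends-on-sum b shift (+ suc n) N =
  trans (shift (+ n) N) (trans (depends-on-sum b shift (+ n) (sucℤ N)) (cong (b 0ℤ) (lemma (+ n) N)))
  where
  lemma : ∀ x y → x +ℤ (1ℤ +ℤ y) ≡ (1ℤ +ℤ x) +ℤ y
  lemma = solve-∀
depends-on-sum b shift -[1+ n ]  N =
  trans (cong (b -[1+ n ]) (sym (lemma N))) (trans (sym (shift -[1+ n ] (- 1ℤ +ℤ N))) (back n))
  where
  lemma : ∀ x → 1ℤ +ℤ (- 1ℤ +ℤ x) ≡ x
  lemma = solve-∀
  lemma' : ∀ x y → x +ℤ (- 1ℤ +ℤ y) ≡ (- 1ℤ +ℤ x) +ℤ y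
  lemma' = solve-∀
  back : ∀ n → b (sucℤ -[1+ n ]) (- 1ℤ +ℤ N) ≡ b 0ℤ (-[1+ n ] +ℤ N)
  back zero    = refl
  back (suc n) = trans (depends-on-sum b shift -[1+ n ] (- 1ℤ +ℤ N)) (cong (b 0ℤ) (lemma' -[1+ n ] N))

-- The two Hankel determinants

toℕ+toℕ-opposite : ∀ {n} (i : Fin (suc n)) → toℕ i + toℕ (opposite i) ≡ n
toℕ+toℕ-opposite i = trans (cong (λ x → toℕ i + x) (Fin.opposite-prop i)) (ℕ.m+[n∸m]≡n (ℕ.≤-pred (Fin.toℕ<n i)))

opposite-anti : ∀ {n} (l i : Fin n) → toℕ l < toℕ i → toℕ (opposite i) < toℕ (opposite l)
opposite-anti {n} l i l<i = subst₂ _<_ (sym (Fin.opposite-prop i)) (sym (Fin.opposite-prop l))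
  (ℕ.∸-monoʳ-< (s≤s l<i) (Fin.toℕ<n i))

-- `X⁺` is the product of `X` and `Tridiag d`, so multiplicativity splits off one factor.
det-shift : ∀ d (X X⁺ Y : Matrix d) → (∀ r x → Σ[< d ] (λ l → X r l *ℤ Tridiag d l x) ≡ X⁺ r x) →
  det d (λ r c → Σ[< d ] (λ x → X⁺ r x *ℤ Y x c)) ≡
  det d (Tridiag d) *ℤ det d (λ r c → Σ[< d ] (λ x → X r x *ℤ Y x c))
det-shift d X X⁺ Y shift = begin
  det d (λ r c → Σ[< d ] (λ x → X⁺ r x *ℤ Y x c))
    ≡⟨ det-* d X⁺ Y ⟩
  det d X⁺ *ℤ det d Y
    ≡⟨ cong (_*ℤ det d Y) (trans (det-cong d (λ r x → sym (shift r x))) (det-* d X (Tridiag d))) ⟩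
  (det d X *ℤ det d (Tridiag d)) *ℤ det d Y
    ≡⟨ lemma (det d X) (det d (Tridiag d)) (det d Y) ⟩
  det d (Tridiag d) *ℤ (det d X *ℤ det d Y)
    ≡⟨ cong (det d (Tridiag d) *ℤ_) (det-* d X Y) ⟨
  det d (Tridiag d) *ℤ det d (λ r c → Σ[< d ] (λ x → X r x *ℤ Y x c)) ∎
  where
  lemma : ∀ x y z → (x *ℤ y) *ℤ z ≡ y *ℤ (x *ℤ z)
  lemma = solve-∀

-- Path vectors in the strip and their reflections

module Strip (K : ℕ) (g : ℤ → ℤ) (ext : IsRecExtension (μ≤ K 𝟏 𝟏) g) where

  -- The reflection `h ↦ K + 2 - h` preserves the indices `1, …, K + 1` of the strip and exchanges
  -- the two boundary indices.
  W V : ℕ → ℤ → ℤ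
  W = U g
  V h = W (suc (suc K) ∸ h)

  W≡paths : ∀ h N → h ≤ suc K → W h (+ N) ≡ paths K h N
  W≡paths = U≡paths K g (proj₁ ext)

  W-tooShort : ∀ h N → h ≤ K → N < h → W (suc h) (+ N) ≡ 0ℤ
  W-tooShort h N h≤K N<h = trans (W≡paths (suc h) N (s≤s h≤K)) (paths-tooShort K h N N<h)

  W-descent : ∀ h → h ≤ K → W (suc h) (+ h) ≡ 1ℤ
  W-descent h h≤K = trans (W≡paths (suc h) h (s≤s h≤K)) (paths-descent K h)

  -- For `N ≥ 0` this is the ceiling of the strip; the recurrence part of `ext` carries it to
  -- negative `N`.
  W-top : ∀ N → W (suc (suc K)) N ≡ 0ℤ
  W-top with proj₂ ext
  ... | e , c , cₑ≢0 , rec =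
    recurrent-vanishes e c (W (suc (suc K))) cₑ≢0 (recurrent-U e c g rec (suc (suc K)))
      (U-aboveTop K g (proj₁ ext))

  W-step : ∀ h N → W (suc h) (sucℤ N) ≡ W h N +ℤ W (suc h) N +ℤ W (suc (suc h)) N
  W-step h N = lemma (W (suc h) (sucℤ N)) (W (suc h) N) (W h N)
    where
    lemma : ∀ x y z → x ≡ z +ℤ y +ℤ (x -ℤ y -ℤ z)
    lemma = solve-∀

  W-orbit : IsOrbit (suc K) W
  W-orbit = record { bottom = λ _ → refl ; top = W-top ; step = λ h N _ → W-step h N }

  -- The step relation treats both neighbours alike, so reflection preserves it and only exchanges
  -- bottom and top.
  V-orbit : IsOrbit (suc K) V
  V-orbit = record
    { bottom = W-top
    ; top    = λ N → cong (λ x → W x N) (ℕ.n∸n≡0 K)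
    ; step   = V-step
    }
    where
    V-step : ∀ h N → h < suc K → V (suc h) (sucℤ N) ≡ V h N +ℤ V (suc h) N +ℤ V (suc (suc h)) N
    V-step h N (s≤s h≤K) = begin
      W (suc K ∸ h) (sucℤ N)
        ≡⟨ cong (λ x → W x (sucℤ N)) eq₁ ⟩
      W (suc p) (sucℤ N)
        ≡⟨ W-step p N ⟩
      W p N +ℤ W (suc p) N +ℤ W (suc (suc p)) N
        ≡⟨ lemma (W p N) (W (suc p) N) (W (suc (suc p)) N) ⟩
      W (suc (suc p)) N +ℤ W (suc p) N +ℤ W p N
        ≡⟨ cong₂ (λ x y → W x N +ℤ W y N +ℤ W p N) eq₂ eq₁ ⟨
      V h N +ℤ V (suc h) N +ℤ V (suc (suc h)) N ∎
      where
      p = K ∸ h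
      eq₁ : suc K ∸ h ≡ suc p
      eq₁ = ℕ.+-∸-assoc 1 h≤K
      eq₂ : suc (suc K) ∸ h ≡ suc (suc p)
      eq₂ = ℕ.+-∸-assoc 2 h≤K
      lemma : ∀ x y z → x +ℤ y +ℤ z ≡ z +ℤ y +ℤ x
      lemma = solve-∀

  ⟨_,_⟩ : (ℕ → ℤ) → (ℕ → ℤ) → ℤ
  ⟨_,_⟩ = pairing (suc K)

  -- At `N = 0` only height 0 admits a path, so the vector is the first unit vector.
  pairing-W₀ : ∀ ψ → ⟨ (λ h → W h 0ℤ) , ψ ⟩ ≡ ψ 1
  pairing-W₀ ψ = begin
    Σ[< suc K ] (λ l → W (suc (toℕ l)) 0ℤ *ℤ ψ (suc (toℕ l)))
      ≡⟨ Σ-headOnly K (λ l → W (suc (toℕ l)) 0ℤ *ℤ ψ (suc (toℕ l)))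
           (λ l → cong (_*ℤ ψ (suc (suc (toℕ l)))) (W-tooShort (suc (toℕ l)) 0 (Fin.toℕ<n l) (s≤s z≤n))) ⟩
    W 1 0ℤ *ℤ ψ 1  ≡⟨ cong (_*ℤ ψ 1) (W-descent 0 z≤n) ⟩
    1ℤ *ℤ ψ 1      ≡⟨ ℤ.*-identityˡ (ψ 1) ⟩
    ψ 1            ∎

  pairing-V₀ : ∀ ψ → ⟨ (λ h → V h 0ℤ) , ψ ⟩ ≡ ψ (suc K)
  pairing-V₀ ψ = begin
    Σ[< suc K ] T
      ≡⟨ Σ-single (suc K) T (fromℕ K) (λ i i≢K → below i (≢fromℕ⇒toℕ< K i i≢K)) ⟩
    T (fromℕ K)
      ≡⟨ cong (λ x → W (suc K ∸ x) 0ℤ *ℤ ψ (suc x)) (Fin.toℕ-fromℕ K) ⟩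
    W (suc K ∸ K) 0ℤ *ℤ ψ (suc K)
      ≡⟨ cong (λ x → W x 0ℤ *ℤ ψ (suc K)) (ℕ.m+n∸n≡m 1 K) ⟩
    W 1 0ℤ *ℤ ψ (suc K)
      ≡⟨ cong (_*ℤ ψ (suc K)) (W-descent 0 z≤n) ⟩
    1ℤ *ℤ ψ (suc K)
      ≡⟨ ℤ.*-identityˡ (ψ (suc K)) ⟩
    ψ (suc K) ∎
    where
    T : Fin (suc K) → ℤ
    T l = V (suc (toℕ l)) 0ℤ *ℤ ψ (suc (toℕ l))
    below : ∀ i → toℕ i < K → T i ≡ 0ℤ
    below i i<K = cong (_*ℤ ψ (suc (toℕ i)))
      (trans (cong (λ x → W x 0ℤ) (ℕ.+-∸-assoc 1 (ℕ.<⇒≤ i<K)))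
             (W-tooShort (K ∸ toℕ i) 0 (ℕ.m∸n≤m K (toℕ i)) (ℕ.m<n⇒0<n∸m i<K)))

  pairing-sum : ∀ f f' → IsOrbit (suc K) f → IsOrbit (suc K) f' → ∀ M N →
    ⟨ (λ h → f h M) , (λ h → f' h N) ⟩ ≡ ⟨ (λ h → f h 0ℤ) , (λ h → f' h (M +ℤ N)) ⟩
  pairing-sum f f' orb orb' =
    depends-on-sum (λ M N → ⟨ (λ h → f h M) , (λ h → f' h N) ⟩) (pairing-suc (suc K) f f' orb orb')

  pairing-WW : ∀ M N → ⟨ (λ h → W h M) , (λ h → W h N) ⟩ ≡ g (M +ℤ N)
  pairing-WW M N = trans (pairing-sum W W W-orbit W-orbit M N) (pairing-W₀ (λ h → W h (M +ℤ N)))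

  pairing-VV : ∀ M N → ⟨ (λ h → V h M) , (λ h → V h N) ⟩ ≡ g (M +ℤ N)
  pairing-VV M N = trans (pairing-sum V V V-orbit V-orbit M N)
    (trans (pairing-V₀ (λ h → V h (M +ℤ N))) (cong (λ x → W x (M +ℤ N)) (ℕ.m+n∸n≡m 1 K)))

  -- Moving everything to the right leaves the number of paths of length `i + j` from height `K` to
  -- 0, which is 0 for want of steps.
  pairing-WV : ∀ i j → i + j < K → ⟨ (λ h → W h (+ i)) , (λ h → V h (+ j)) ⟩ ≡ 0ℤ
  pairing-WV i j i+j<K = trans (pairing-sum W V W-orbit V-orbit (+ i) (+ j))
    (trans (pairing-W₀ (λ h → V h (+ i +ℤ + j))) (W-tooShort K (i + j) ℕ.≤-refl i+j<K))

  -- Paths of length `i < k` to height 0 start below height `k`. Truncating the sum makes the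
  -- factors square, as `det-gram` requires.
  pairing-WW-truncated : ∀ k → k ≤ suc K → ∀ i j → i < k →
    g (+ (i + j)) ≡ Σ[< k ] (λ l → W (suc (toℕ l)) (+ i) *ℤ W (suc (toℕ l)) (+ j))
  pairing-WW-truncated k k≤d i j i<k = trans (sym (pairing-WW (+ i) (+ j)))
    (Σ-truncate k (suc K) (λ l → W (suc l) (+ i) *ℤ W (suc l) (+ j)) k≤d
      (λ l k≤l l<d → cong (_*ℤ W (suc l) (+ j)) (W-tooShort l i (ℕ.≤-pred l<d) (ℕ.≤-trans i<k k≤l))))

  -- Here `L` is the triangle of path counts, with the length as row and the starting height as
  -- column.
  det-hankel₀ : ∀ k → k ≤ suc K → det k (λ i j → g (+ (toℕ i + toℕ j))) ≡ 1ℤ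
  det-hankel₀ k k≤d = trans
    (det-cong k (λ i j → pairing-WW-truncated k k≤d (toℕ i) (toℕ j) (Fin.toℕ<n i)))
    (det-gram k (λ i l → W (suc (toℕ l)) (+ toℕ i))
      (λ i l → W-tooShort (toℕ l) (toℕ i) (≤K l))
      (λ i → W-descent (toℕ i) (≤K i)))
    where
    ≤K : ∀ (l : Fin k) → toℕ l ≤ K
    ≤K l = ℕ.≤-pred (ℕ.≤-trans (Fin.toℕ<n l) k≤d)

  -- Reversing the summation index along with the rows turns the lower unitriangular factor into an
  -- upper one.
  det-hankel₀-opposite : ∀ m → m ≤ suc K →
    det m (λ i j → g (+ (toℕ (opposite i) + toℕ (opposite j)))) ≡ 1ℤ
  det-hankel₀-opposite m m≤d = trans
    (det-cong m (λ i j → trans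
      (pairing-WW-truncated m m≤d (toℕ (opposite i)) (toℕ (opposite j)) (Fin.toℕ<n (opposite i)))
      (sym (Σ-reverse m (λ l → W (suc (toℕ l)) (+ toℕ (opposite i)) *ℤ W (suc (toℕ l)) (+ toℕ (opposite j)))))))
    (det-gramᵀ m (λ i l → W (suc (toℕ (opposite l))) (+ toℕ (opposite i)))
      (λ i l l<i → W-tooShort (toℕ (opposite l)) (toℕ (opposite i)) (≤K (opposite l)) (opposite-anti l i l<i))
      (λ i → W-descent (toℕ (opposite i)) (≤K (opposite i))))
    where
    ≤K : ∀ (l : Fin m) → toℕ l ≤ K
    ≤K l = ℕ.≤-pred (ℕ.≤-trans (Fin.toℕ<n l) m≤d)

-- Both sides of det-hankel are corners of det (X t · Yᵀ), where the rows of Y are the vectors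
-- W (m-1), …, W 0, V 0, …, V (k-1) and those of X t are W (m-1-s+t), …, W (t-s),
-- V t, …, V (t+k-1). The product is block upper triangular at t = 0 and block lower
-- triangular at t = s, and Tridiag carries X t to X (t+1).
module TwoBlocks (m' k : ℕ) (g : ℤ → ℤ) (ext : IsRecExtension (μ≤ (m' + k) 𝟏 𝟏) g) (n : ℕ) where

  open Strip (m' + k) g ext

  -- Writing `m` as `suc m'` makes `d` compute to `suc (m' + k)`, the size used in `Strip`, and
  -- expresses `n + 2m - 2` without subtraction.
  m d s : ℕ
  m = suc m'
  d = m + k
  s = n + 2 * m'

  X : ℕ → Fin m ⊎ Fin k → ℕ → ℤ
  X t (inj₁ i) h = W h (+ t +ℤ (+ toℕ (opposite i) -ℤ + s))
  X t (inj₂ i) h = V h (+ t +ℤ + toℕ i)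

  Y : Fin m ⊎ Fin k → ℕ → ℤ
  Y (inj₁ j) h = W h (+ toℕ (opposite j))
  Y (inj₂ j) h = V h (+ toℕ j)

  P : ℕ → Fin m ⊎ Fin k → Fin m ⊎ Fin k → ℤ
  P t r c = ⟨ X t r , Y c ⟩

  detP : ℕ → ℤ
  detP t = det d (λ r c → P t (splitAt m r) (splitAt m c))

  detP-suc : ∀ t → detP (suc t) ≡ det d (Tridiag d) *ℤ detP t
  detP-suc t = det-shift d (λ r x → X t (splitAt m r) (suc (toℕ x))) (λ r x → X (suc t) (splitAt m r) (suc (toℕ x)))
    (λ x c → Y (splitAt m c) (suc (toℕ x))) (λ r → shift (splitAt m r))
    where
    lemma : ∀ x y → 1ℤ +ℤ (x +ℤ y) ≡ (1ℤ +ℤ x) +ℤ y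
    lemma = solve-∀
    shift : ∀ r x → Σ[< d ] (λ l → X t r (suc (toℕ l)) *ℤ Tridiag d l x) ≡ X (suc t) r (suc (toℕ x))
    shift (inj₁ i) x = trans (orbit-Tridiag d W W-orbit (+ t +ℤ (+ toℕ (opposite i) -ℤ + s)) x)
      (cong (W (suc (toℕ x))) (lemma (+ t) (+ toℕ (opposite i) -ℤ + s)))
    shift (inj₂ i) x = orbit-Tridiag d V V-orbit (+ t +ℤ + toℕ i) x

  detP-iterate : ∀ t → detP t ≡ det d (Tridiag d) ^ t *ℤ detP 0
  detP-iterate zero    = sym (ℤ.*-identityˡ (detP 0))
  detP-iterate (suc t) = begin
    detP (suc t)                                        ≡⟨ detP-suc t ⟩
    ε *ℤ detP t                                         ≡⟨ cong (ε *ℤ_) (detP-iterate t) ⟩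
    ε *ℤ (ε ^ t *ℤ detP 0)                              ≡⟨ ℤ.*-assoc ε (ε ^ t) (detP 0) ⟨
    ε ^ suc t *ℤ detP 0                                 ∎
    where ε = det d (Tridiag d)

  blocks : ∀ t → (det d (λ r c → P t (splitAt m r) (splitAt m c)) ≡
      det m (λ i j → P t (splitAt m (i ↑ˡ k)) (splitAt m (j ↑ˡ k))) *ℤ
      det k (λ i j → P t (splitAt m (m ↑ʳ i)) (splitAt m (m ↑ʳ j)))) →
    detP t ≡ det m (λ i j → P t (inj₁ i) (inj₁ j)) *ℤ det k (λ i j → P t (inj₂ i) (inj₂ j))
  blocks t eq = trans eq (cong₂ _*ℤ_
    (det-cong m (λ i j → cong₂ (P t) (Fin.splitAt-↑ˡ m i k) (Fin.splitAt-↑ˡ m j k)))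
    (det-cong k (λ i j → cong₂ (P t) (Fin.splitAt-↑ʳ m k i) (Fin.splitAt-↑ʳ m k j))))

  -- The largest indices, `m'` and `k - 1`, add up to exactly one less than the top height, so
  -- `pairing-WV` covers the whole block.
  offDiagonal : ∀ (i : Fin m) (j : Fin k) → toℕ i + toℕ j < m' + k
  offDiagonal i j = ℕ.+-mono-≤-< (ℕ.≤-pred (Fin.toℕ<n i)) (Fin.toℕ<n j)

  -- Each reversed index contributes `m'`, and the summand `2 * m'` of `s` cancels both.
  opposite-sum : ∀ (i j : Fin m) →
    + 0 +ℤ (+ toℕ (opposite i) -ℤ + s) +ℤ + toℕ (opposite j) ≡ - + (n + toℕ i + toℕ j)
  opposite-sum i j = lemma (+ toℕ (opposite i)) (+ toℕ (opposite j)) (+ toℕ i) (+ toℕ j) (+ n) (+ m')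
    (cong +_ (toℕ+toℕ-opposite i)) (cong +_ (toℕ+toℕ-opposite j))
    where
    identity : ∀ a b i j n m → 0ℤ +ℤ (a -ℤ (n +ℤ (m +ℤ (m +ℤ 0ℤ)))) +ℤ b
      ≡ ((i +ℤ a) -ℤ m) +ℤ ((j +ℤ b) -ℤ m) +ℤ - (n +ℤ i +ℤ j)
    identity = solve-∀
    cancel : ∀ x y → (x -ℤ x) +ℤ (x -ℤ x) +ℤ y ≡ y
    cancel = solve-∀
    lemma : ∀ a b i j n m → i +ℤ a ≡ m → j +ℤ b ≡ m →
      0ℤ +ℤ (a -ℤ (n +ℤ (m +ℤ (m +ℤ 0ℤ)))) +ℤ b ≡ - (n +ℤ i +ℤ j)
    lemma a b i j n m eq₁ eq₂ = trans (identity a b i j n m)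
      (trans (cong₂ (λ x y → (x -ℤ m) +ℤ (y -ℤ m) +ℤ - (n +ℤ i +ℤ j)) eq₁ eq₂) (cancel m (- (n +ℤ i +ℤ j))))

  detP₀ : detP 0 ≡ det m (λ i j → g (- + (n + toℕ i + toℕ j)))
  detP₀ = begin
    detP 0
      ≡⟨ blocks 0 (det-upperBlock m k (λ r c → P 0 (splitAt m r) (splitAt m c)) zeros) ⟩
    det m (λ i j → P 0 (inj₁ i) (inj₁ j)) *ℤ det k (λ i j → P 0 (inj₂ i) (inj₂ j))
      ≡⟨ cong₂ _*ℤ_
           (det-cong m (λ i j → trans (pairing-WW (+ 0 +ℤ (+ toℕ (opposite i) -ℤ + s)) (+ toℕ (opposite j)))
                                      (cong g (opposite-sum i j))))
           (trans (det-cong k (λ i j → pairing-VV (+ toℕ i) (+ toℕ j)))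
                  (det-hankel₀ k (ℕ.m≤n+m k m))) ⟩
    det m (λ i j → g (- + (n + toℕ i + toℕ j))) *ℤ 1ℤ
      ≡⟨ ℤ.*-identityʳ (det m (λ i j → g (- + (n + toℕ i + toℕ j)))) ⟩
    det m (λ i j → g (- + (n + toℕ i + toℕ j))) ∎
    where
    zeros : ∀ i j → P 0 (splitAt m (m ↑ʳ i)) (splitAt m (j ↑ˡ k)) ≡ 0ℤ
    zeros i j = begin
      P 0 (splitAt m (m ↑ʳ i)) (splitAt m (j ↑ˡ k))
        ≡⟨ cong₂ (P 0) (Fin.splitAt-↑ʳ m k i) (Fin.splitAt-↑ˡ m j k) ⟩
      P 0 (inj₂ i) (inj₁ j)
        ≡⟨ pairing-comm d (X 0 (inj₂ i)) (Y (inj₁ j)) ⟩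
      ⟨ (λ h → W h (+ toℕ (opposite j))) , (λ h → V h (+ toℕ i)) ⟩
        ≡⟨ pairing-WV (toℕ (opposite j)) (toℕ i) (offDiagonal (opposite j) i) ⟩
      0ℤ ∎

  detPₛ : detP s ≡ det k (λ i j → g (+ (s + toℕ i + toℕ j)))
  detPₛ = begin
    detP s
      ≡⟨ blocks s (det-lowerBlock m k (λ r c → P s (splitAt m r) (splitAt m c)) zeros) ⟩
    det m (λ i j → P s (inj₁ i) (inj₁ j)) *ℤ det k (λ i j → P s (inj₂ i) (inj₂ j))
      ≡⟨ cong₂ _*ℤ_
           (trans (det-cong m (λ i j → trans
                    (cong (λ M → ⟨ (λ h → W h M) , Y (inj₁ j) ⟩) (cancel (+ s) (+ toℕ (opposite i))))
                    (pairing-WW (+ toℕ (opposite i)) (+ toℕ (opposite j)))))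
                  (det-hankel₀-opposite m (ℕ.m≤m+n m k)))
           (det-cong k (λ i j → pairing-VV (+ s +ℤ + toℕ i) (+ toℕ j))) ⟩
    1ℤ *ℤ det k (λ i j → g (+ (s + toℕ i + toℕ j)))
      ≡⟨ ℤ.*-identityˡ (det k (λ i j → g (+ (s + toℕ i + toℕ j)))) ⟩
    det k (λ i j → g (+ (s + toℕ i + toℕ j))) ∎
    where
    cancel : ∀ x y → x +ℤ (y -ℤ x) ≡ y
    cancel = solve-∀
    zeros : ∀ i j → P s (splitAt m (i ↑ˡ k)) (splitAt m (m ↑ʳ j)) ≡ 0ℤ
    zeros i j = begin
      P s (splitAt m (i ↑ˡ k)) (splitAt m (m ↑ʳ j))
        ≡⟨ cong₂ (P s) (Fin.splitAt-↑ˡ m i k) (Fin.splitAt-↑ʳ m k j) ⟩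
      P s (inj₁ i) (inj₂ j)
        ≡⟨ cong (λ M → ⟨ (λ h → W h M) , Y (inj₂ j) ⟩) (cancel (+ s) (+ toℕ (opposite i))) ⟩
      ⟨ (λ h → W h (+ toℕ (opposite i))) , (λ h → V h (+ toℕ j)) ⟩
        ≡⟨ pairing-WV (toℕ (opposite i)) (toℕ j) (offDiagonal (opposite i) j) ⟩
      0ℤ ∎

  det-hankel : det k (λ i j → g (+ (s + toℕ i + toℕ j))) ≡
    det d (Tridiag d) ^ s *ℤ det m (λ i j → g (- + (n + toℕ i + toℕ j)))
  det-hankel = trans (sym detPₛ) (trans (detP-iterate s) (cong (det d (Tridiag d) ^ s *ℤ_) detP₀))

-- The even part `2 * m` of the exponent contributes a power of `(- 1ℤ) ^ 2`, which computes to
-- `1ℤ`.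
sign-power : ∀ q n m → ((- 1ℤ) ^ q) ^ (n + 2 * m) ≡ (- 1ℤ) ^ (n * q)
sign-power q n m = begin
  ((- 1ℤ) ^ q) ^ (n + 2 * m)                ≡⟨ ℤ.^-*-assoc (- 1ℤ) q (n + 2 * m) ⟩
  (- 1ℤ) ^ (q * (n + 2 * m))                ≡⟨ cong ((- 1ℤ) ^_) (lemma q n m) ⟩
  (- 1ℤ) ^ (n * q + 2 * (q * m))            ≡⟨ ℤ.^-distribˡ-+-* (- 1ℤ) (n * q) (2 * (q * m)) ⟩
  (- 1ℤ) ^ (n * q) *ℤ (- 1ℤ) ^ (2 * (q * m))
    ≡⟨ cong ((- 1ℤ) ^ (n * q) *ℤ_) (trans (sym (ℤ.^-*-assoc (- 1ℤ) 2 (q * m))) (ℤ.^-zeroˡ (q * m))) ⟩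
  (- 1ℤ) ^ (n * q) *ℤ 1ℤ                    ≡⟨ ℤ.*-identityʳ ((- 1ℤ) ^ (n * q)) ⟩
  (- 1ℤ) ^ (n * q)                          ∎
  where
  lemma : ∀ q n m → q * (n + 2 * m) ≡ n * q + 2 * (q * m)
  lemma = ℕSolver.solve-∀

theorem1p5 : (n k m : ℕ) → 1 ≤ n → 1 ≤ k → 1 ≤ m → (k + m) % 3 ≢ 2 →
    (g : ℤ → ℤ) → IsRecExtension (μ≤ (k + m ∸ 1) 𝟏 𝟏) g →
    det k (λ i j → g (+ (n + toℕ i + toℕ j + 2 * m ∸ 2)))
    ≡ ((- 1ℤ) ^ (n * ((k + m) / 3)))
    *ℤ det m (λ i j → g (- (+ (n + toℕ i + toℕ j))))
theorem1p5 n k (suc m') _ _ _ k+m%3≢2 g ext = begin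
  det k (λ i j → g (+ (n + toℕ i + toℕ j + 2 * suc m' ∸ 2)))
    ≡⟨ det-cong k (λ i j → cong (λ x → g (+ x)) (index (toℕ i) (toℕ j))) ⟩
  det k (λ i j → g (+ (n + 2 * m' + toℕ i + toℕ j)))
    -- After commuting the sum, `suc m' + k ∸ 1` computes to `m' + k`, the top height expected by
    -- `TwoBlocks`.
    ≡⟨ TwoBlocks.det-hankel m' k g (subst (λ K → IsRecExtension (μ≤ K 𝟏 𝟏) g)
         (cong (_∸ 1) (ℕ.+-comm k (suc m'))) ext) n ⟩
  det (suc m' + k) (Tridiag (suc m' + k)) ^ (n + 2 * m') *ℤ R
    ≡⟨ cong (λ d → det d (Tridiag d) ^ (n + 2 * m') *ℤ R) (ℕ.+-comm k (suc m')) ⟨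
  det (k + suc m') (Tridiag (k + suc m')) ^ (n + 2 * m') *ℤ R
    ≡⟨ cong (λ ε → ε ^ (n + 2 * m') *ℤ R) (det-Tridiag (k + suc m') k+m%3≢2) ⟩
  ((- 1ℤ) ^ ((k + suc m') / 3)) ^ (n + 2 * m') *ℤ R
    ≡⟨ cong (_*ℤ R) (sign-power ((k + suc m') / 3) n m') ⟩
  ((- 1ℤ) ^ (n * ((k + suc m') / 3))) *ℤ R ∎
  where
  R = det (suc m') (λ i j → g (- (+ (n + toℕ i + toℕ j))))
  lemma : ∀ n i j m → n + i + j + 2 * (1 + m) ≡ n + 2 * m + i + j + 2
  lemma = ℕSolver.solve-∀
  index : ∀ i j → n + i + j + 2 * suc m' ∸ 2 ≡ n + 2 * m' + i + j
  index i j = trans (cong (_∸ 2) (lemma n i j m')) (ℕ.m+n∸n≡m (n + 2 * m' + i + j) 2)
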